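{- Let $D=\begin{bmatrix}1&1&0\\1&1&1\\0&1&1\end{bmatrix}$ be the bipartite adjacency matrix of the Domino graph. Then the asymptotic fractional binary rank (equivalently, the asymptotic fractional biclique partition number) of $D$ satisfies \[ \mathsf{bp}_f^\infty(D)\in[2,\,2.372713]. \] In general, for every binary matrix $A$, \[ i(A)\le \mathsf{bc}_f(A)\le \mathsf{bp}_f^\infty(A)\le \mathsf{bp}_f(A)\le \mathsf{bp}(A). \]
   Context: A binary matrix is a matrix with all entries in $\{0,1\}$. For an $n\times m$ binary matrix $A$, let $G_A$ be the bipartite graph with one vertex for each row and one for each column, and with an edge between row $i$ and column $j$ exactly when $A_{ij}=1$; edges of $G_A$ are identified with the one-entries of $A$. A biclique of $G_A$ is a complete bipartite subgraph with at least one edge; equivalently, it is a nonzero binary rank-one matrix $uv^T$ with $u\in\{0,1\}^n$, $v\in\{0,1\}^m$ and $uv^T\le A$ entrywise. Bicliques need not be inclusion-wise maximal. Let $N$ be the number of bicliques of $G_A$ and let $M$ be the binary edge-biclique incidence matrix, with one row for each edge and one column for each of the $N$ bicliques, where an entry is $1$ iff the edge belongs to the biclique. Let $\mathbb{1}$ denote an all-ones vector of appropriate dimension. Define - the biclique partition number (equal to the binary rank) $\mathsf{bp}(A)=\min\{\mathbb{1}^Tx : Mx=\mathbb{1},\ x\in\{0,1\}^N\}$; - the fractional biclique partition number (fractional binary rank) $\mathsf{bp}_f(A)=\min\{\mathbb{1}^Tx : Mx=\mathbb{1},\ x\ge 0\}$; - the fractional biclique cover number (fractional Boolean rank) $\mathsf{bc}_f(A)=\min\{\mathbb{1}^Tx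 : Mx\ge\mathbb{1},\ x\ge 0\}$. The isolation-set number $i(A)$ is the maximum size of a set of one-entries of $A$ such that no two of them are contained in a common all-ones submatrix of $A$ (a fooling set; submatrices are given by arbitrary, not necessarily contiguous, sets of rows and columns). Let $A^{\otimes k}$ denote the $k$-fold Kronecker power of $A$. Since $\mathsf{bp}_f$ is sub-multiplicative with respect to the Kronecker product, the asymptotic fractional binary rank (asymptotic fractional biclique partition number) \[ \mathsf{bp}_f^\infty(A):=\lim_{k\to\infty}\sqrt[k]{\mathsf{bp}_f(A^{\otimes k})} \] is well-defined by Fekete's Lemma, and it equals $\inf\{\sqrt[k]{\mathsf{bp}_f(A^{\otimes k})} : k\in\mathbb{Z}_{>0}\}$. -}

module Defs where

open import Algebra.Bundles.Raw using (RawSemiring)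
import Algebra.Definitions.RawSemiring as RawSemiringDefs
open import Data.Bool.Base using (Bool; true; false; _∧_; if_then_else_)
import Data.Bool.Properties as Bool
open import Data.Fin.Base using (Fin; quotient; remainder)
open import Data.Fin.Properties using (all?)
open import Data.Fin.Subset using (Subset; inside; outside; _∈_; Nonempty)
open import Data.Fin.Subset.Properties using (_∈?_; nonempty?)
open import Data.Integer.Base using (+_)
open import Data.List.Base as List using (List; _∷_; []; length; filter; cartesianProduct; cartesianProductWith)
open import Data.List.Membership.Propositional using () renaming (_∈_ to _∈ˡ_)
open import Data.List.Relation.Unary.Unique.Propositional using (Unique)
open import Data.Nat.Base as ℕ using (ℕ; zero; suc)
import Data.Nat.Properties as ℕ
open import Data.Product.Base using (∃; ∃₂; _×_; _,_; proj₁; proj₂)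
open import Data.Rational.Base as ℚ using (ℚ; 0ℚ; 1ℚ; ½; ∣_∣; 1/_)
import Data.Rational.Properties as ℚ
import Data.Rational.Solver as ℚSolver
open import Data.Sum.Base using (_⊎_)
open import Data.Vec.Base as Vec using (Vec; _∷_; [])
open import Data.Vec.Functional using (Vector)
open import Function.Base using (_∘_)
open import Level using (0ℓ)
open import Relation.Binary.PropositionalEquality
  using (_≡_; _≢_; refl; sym; trans; cong; cong₂; subst)
open import Relation.Nullary.Decidable.Core using (Dec; does; _×-dec_; _→-dec_)
open import Relation.Nullary.Negation.Core using (¬_)

-- Real numbers: Cauchy sequences of rationals, compared as a setoid.
--
-- Tails are quantified by a double-negated existential.  Classically this
-- is the usual notion; constructively it asks for no modulus of
-- convergence, which matters because Fekete's Lemma does not provide one.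

Eventually : (ℕ → Set) → Set
Eventually P = ¬ ¬ (∃ λ N → ∀ n → N ℕ.≤ n → P n)

record ℝ : Set where
  constructor mkℝ
  field
    seq    : ℕ → ℚ
    cauchy : ∀ ε → 0ℚ ℚ.< ε →
             ¬ ¬ (∃ λ N → ∀ m n → N ℕ.≤ m → N ℕ.≤ n → ∣ seq m ℚ.- seq n ∣ ℚ.≤ ε)

open ℝ public

infix 4 _≤_ _≃_

_≤_ : ℝ → ℝ → Set
x ≤ y = ∀ ε → 0ℚ ℚ.< ε → Eventually λ n → seq x n ℚ.≤ seq y n ℚ.+ ε

_≃_ : ℝ → ℝ → Set
x ≃ y = x ≤ y × y ≤ x

fromℚ : ℚ → ℝ
fromℚ q = mkℝ (λ _ → q) λ ε ε>0 ¬N → ¬N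
  (0 , λ _ _ _ _ → subst (ℚ._≤ ε) (sym (cong ∣_∣ (ℚ.+-inverseʳ q))) (ℚ.<⇒≤ ε>0))

fromℕ : ℕ → ℝ
fromℕ n = fromℚ (+ n ℚ./ 1)

0ℝ 1ℝ : ℝ
0ℝ = fromℚ 0ℚ
1ℝ = fromℚ 1ℚ

private
  open ℚSolver.+-*-Solver

  ½-pos : ∀ {ε} → 0ℚ ℚ.< ε → 0ℚ ℚ.< ε ℚ.* ½
  ½-pos {ε} ε>0 =
    subst (ℚ._< ε ℚ.* ½) (ℚ.*-zeroˡ ½) (ℚ.*-monoˡ-<-pos ½ ε>0)

  ½+½ : ∀ ε → ε ℚ.* ½ ℚ.+ ε ℚ.* ½ ≡ ε
  ½+½ ε = trans (sym (ℚ.*-distribˡ-+ ε ½ ½)) (ℚ.*-identityʳ ε)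

  +-diff : ∀ a b c d → (a ℚ.+ b) ℚ.- (c ℚ.+ d) ≡ (a ℚ.- c) ℚ.+ (b ℚ.- d)
  +-diff = solve 4 (λ a b c d → (a :+ b) :- (c :+ d) := (a :- c) :+ (b :- d)) refl

  *-diff : ∀ a b c d → (a ℚ.* b) ℚ.- (c ℚ.* d) ≡ a ℚ.* (b ℚ.- d) ℚ.+ d ℚ.* (a ℚ.- c)
  *-diff = solve 4 (λ a b c d → (a :* b) :- (c :* d) := a :* (b :- d) :+ d :* (a :- c)) refl

  undiff : ∀ a b → a ≡ b ℚ.+ (a ℚ.- b)
  undiff = solve 2 (λ a b → a := b :+ (a :- b)) refl

  EventuallyBounded : (ℕ → ℚ) → Set
  EventuallyBounded s = ∃ λ B → 0ℚ ℚ.< B × ∃ λ N → ∀ n → N ℕ.≤ n → ∣ s n ∣ ℚ.≤ B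

  bounded : ∀ x → ¬ ¬ EventuallyBounded (seq x)
  bounded x k = cauchy x 1ℚ (ℚ.positive⁻¹ 1ℚ) λ (N , h) → k
    ( ∣ seq x N ∣ ℚ.+ 1ℚ
    , ℚ.+-mono-≤-< (ℚ.0≤∣p∣ (seq x N)) (ℚ.positive⁻¹ 1ℚ)
    , N
    , λ n N≤n → ℚ.≤-trans
        (ℚ.≤-reflexive (cong ∣_∣ (undiff (seq x n) (seq x N))))
        (ℚ.≤-trans (ℚ.∣p+q∣≤∣p∣+∣q∣ (seq x N) (seq x n ℚ.- seq x N))
                   (ℚ.+-monoʳ-≤ ∣ seq x N ∣ (h n N N≤n ℕ.≤-refl))))

  scaled : ∀ {ε B} → 0ℚ ℚ.< ε → 0ℚ ℚ.< B →
           ∃ λ δ → 0ℚ ℚ.< δ × (∀ p q → ∣ p ∣ ℚ.≤ B → ∣ q ∣ ℚ.≤ δ → ∣ p ℚ.* q ∣ ℚ.≤ ε)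
  scaled {ε} {B} ε>0 B>0 = δ , δ>0 , λ p q p≤B q≤δ →
      ℚ.≤-trans (ℚ.≤-reflexive (ℚ.∣p*q∣≡∣p∣*∣q∣ p q))
     (ℚ.≤-trans (ℚ.*-monoʳ-≤-nonNeg ∣ q ∣ {{ℚ.nonNegative (ℚ.0≤∣p∣ q)}} p≤B)
     (ℚ.≤-trans (ℚ.*-monoˡ-≤-nonNeg B {{ℚ.pos⇒nonNeg B}} q≤δ)
                (ℚ.≤-reflexive Bδ≡ε)))
    where
    instance
      B⁺ = ℚ.positive B>0
      B≢0 = ℚ.pos⇒nonZero B
    δ = ε ℚ.* 1/ B
    δ>0 : 0ℚ ℚ.< δ
    δ>0 = subst (ℚ._< δ) (ℚ.*-zeroˡ (1/ B))
      (ℚ.*-monoˡ-<-pos (1/ B) {{ℚ.1/pos⇒pos B}} ε>0)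
    Bδ≡ε : B ℚ.* δ ≡ ε
    Bδ≡ε = trans (solve 3 (λ b e i → b :* (e :* i) := e :* (b :* i)) refl B ε (1/ B))
      (trans (cong (ε ℚ.*_) (ℚ.*-inverseʳ B)) (ℚ.*-identityʳ ε))

infixl 6 _+_
infixl 7 _*_

_+_ : ℝ → ℝ → ℝ
x + y = mkℝ (λ n → seq x n ℚ.+ seq y n) λ ε ε>0 k →
  cauchy x (ε ℚ.* ½) (½-pos ε>0) λ (N₁ , h₁) →
  cauchy y (ε ℚ.* ½) (½-pos ε>0) λ (N₂ , h₂) →
  k (N₁ ℕ.⊔ N₂ , λ m n N≤m N≤n → ℚ.≤-trans
      (ℚ.≤-reflexive (cong ∣_∣ (+-diff (seq x m) (seq y m) (seq x n) (seq y n))))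
      (ℚ.≤-trans (ℚ.∣p+q∣≤∣p∣+∣q∣ (seq x m ℚ.- seq x n) (seq y m ℚ.- seq y n))
      (ℚ.≤-trans
        (ℚ.+-mono-≤
          (h₁ m n (ℕ.m⊔n≤o⇒m≤o N₁ N₂ N≤m) (ℕ.m⊔n≤o⇒m≤o N₁ N₂ N≤n))
          (h₂ m n (ℕ.m⊔n≤o⇒n≤o N₁ N₂ N≤m) (ℕ.m⊔n≤o⇒n≤o N₁ N₂ N≤n)))
        (ℚ.≤-reflexive (½+½ ε)))))

_*_ : ℝ → ℝ → ℝ
x * y = mkℝ (λ n → seq x n ℚ.* seq y n) λ ε ε>0 k →
  bounded x λ (B₁ , B₁>0 , K₁ , b₁) →
  bounded y λ (B₂ , B₂>0 , K₂ , b₂) →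
  let (δ₁ , δ₁>0 , s₁) = scaled (½-pos ε>0) B₁>0
      (δ₂ , δ₂>0 , s₂) = scaled (½-pos ε>0) B₂>0
  in
  cauchy y δ₁ δ₁>0 λ (N₁ , h₁) →
  cauchy x δ₂ δ₂>0 λ (N₂ , h₂) →
  let K = K₁ ℕ.⊔ K₂
      N = N₁ ℕ.⊔ N₂
  in
  k (K ℕ.⊔ N , λ m n ≤m ≤n →
    let K≤m = ℕ.m⊔n≤o⇒m≤o K N ≤m
        K≤n = ℕ.m⊔n≤o⇒m≤o K N ≤n
        N≤m = ℕ.m⊔n≤o⇒n≤o K N ≤m
        N≤n = ℕ.m⊔n≤o⇒n≤o K N ≤n
    in
    ℚ.≤-trans
      (ℚ.≤-reflexive (cong ∣_∣ (*-diff (seq x m) (seq y m) (seq x n) (seq y n))))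
      (ℚ.≤-trans (ℚ.∣p+q∣≤∣p∣+∣q∣ (seq x m ℚ.* (seq y m ℚ.- seq y n))
                                  (seq y n ℚ.* (seq x m ℚ.- seq x n)))
      (ℚ.≤-trans
        (ℚ.+-mono-≤
          (s₁ (seq x m) (seq y m ℚ.- seq y n)
              (b₁ m (ℕ.m⊔n≤o⇒m≤o K₁ K₂ K≤m))
              (h₁ m n (ℕ.m⊔n≤o⇒m≤o N₁ N₂ N≤m) (ℕ.m⊔n≤o⇒m≤o N₁ N₂ N≤n)))
          (s₂ (seq y n) (seq x m ℚ.- seq x n)
              (b₂ n (ℕ.m⊔n≤o⇒n≤o K₁ K₂ K≤n))
              (h₂ m n (ℕ.m⊔n≤o⇒n≤o N₁ N₂ N≤m) (ℕ.m⊔n≤o⇒n≤o N₁ N₂ N≤n))))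
        (ℚ.≤-reflexive (½+½ ε)))))

ℝ-rawSemiring : RawSemiring 0ℓ 0ℓ
ℝ-rawSemiring = record
  { Carrier = ℝ ; _≈_ = _≃_ ; _+_ = _+_ ; _*_ = _*_ ; 0# = 0ℝ ; 1# = 1ℝ }

open RawSemiringDefs ℝ-rawSemiring public using (sum; _^_)

infix 4 _⟶_

_⟶_ : (ℕ → ℝ) → ℝ → Set
ρ ⟶ L = ∀ ε → 0ℚ ℚ.< ε →
  Eventually λ k → ρ k ≤ L + fromℚ ε × L ≤ ρ k + fromℚ ε

IsRoot : ℕ → ℝ → ℝ → Set
IsRoot k v r = 0ℝ ≤ r × r ^ k ≃ v

BinMatrix : ℕ → ℕ → Set
BinMatrix n m = Fin n → Fin m → Bool

infixl 7 _⊗_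
infixl 8 _^⊗_

_⊗_ : ∀ {n m p q} → BinMatrix n m → BinMatrix p q → BinMatrix (n ℕ.* p) (m ℕ.* q)
_⊗_ {n} {m} {p} {q} A B i j =
  A (quotient p i) (quotient q j) ∧ B (remainder {n} p i) (remainder {m} q j)

_^⊗_ : ∀ {n m} → BinMatrix n m → (k : ℕ) → BinMatrix (n ℕ.^ k) (m ℕ.^ k)
A ^⊗ zero  = λ _ _ → true
A ^⊗ suc k = A ⊗ (A ^⊗ k)

domino : BinMatrix 3 3
domino i j = Vec.lookup (Vec.lookup rows i) j
  where
  rows : Vec (Vec Bool 3) 3
  rows = (true  ∷ true ∷ false ∷ [])
       ∷ (true  ∷ true ∷ true  ∷ [])
       ∷ (false ∷ true ∷ true  ∷ [])
       ∷ []

subsets : ∀ n → List (Subset n)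
subsets zero    = [] ∷ []
subsets (suc n) = cartesianProductWith _∷_ (outside ∷ inside ∷ []) (subsets n)

module _ {n m} (A : BinMatrix n m) where

  AllOnes : Subset n → Subset m → Set
  AllOnes U V = ∀ i j → i ∈ U → j ∈ V → A i j ≡ true

  IsBiclique : Subset n × Subset m → Set
  IsBiclique (U , V) = Nonempty U × Nonempty V × AllOnes U V

  isBiclique? : ∀ R → Dec (IsBiclique R)
  isBiclique? (U , V) = nonempty? U ×-dec nonempty? V ×-dec
    all? λ i → all? λ j → (i ∈? U) →-dec (j ∈? V) →-dec (A i j Bool.≟ true)

  bicliques : List (Subset n × Subset m)
  bicliques = filter isBiclique? (cartesianProduct (subsets n) (subsets m))

  #bicliques : ℕ
  #bicliques = length bicliques

  -- The incidence matrix M is indexed here by all positions (i , j); its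
  -- rows are the positions with A i j ≡ true.
  incidence : Fin n → Fin m → Vector ℝ #bicliques
  incidence i j b = if does (i ∈? U) ∧ does (j ∈? V) then 1ℝ else 0ℝ
    where
    U = proj₁ (List.lookup bicliques b)
    V = proj₂ (List.lookup bicliques b)

  infixr 8 M·_
  M·_ : Vector ℝ #bicliques → Fin n → Fin m → ℝ
  (M· x) i j = sum λ b → incidence i j b * x b

  Partition Cover NonNegative ZeroOne : Vector ℝ #bicliques → Set
  Partition x   = ∀ i j → A i j ≡ true → (M· x) i j ≃ 1ℝ
  Cover x       = ∀ i j → A i j ≡ true → 1ℝ ≤ (M· x) i j
  NonNegative x = ∀ b → 0ℝ ≤ x b
  ZeroOne x     = ∀ b → x b ≃ 0ℝ ⊎ x b ≃ 1ℝ

IsMinTotal : ∀ {N} → (Vector ℝ N → Set) → ℝ → Set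
IsMinTotal Feasible v =
  (∃ λ x → Feasible x × sum x ≃ v) × (∀ x → Feasible x → v ≤ sum x)

-- Each parameter is given as the relation "v is its value at A", which
-- determines v up to _≃_ (or _≡_ for i).

module _ {n m} (A : BinMatrix n m) where

  Is-bp : ℝ → Set
  Is-bp = IsMinTotal λ x → Partition A x × ZeroOne A x

  Is-bpf : ℝ → Set
  Is-bpf = IsMinTotal λ x → Partition A x × NonNegative A x

  Is-bcf : ℝ → Set
  Is-bcf = IsMinTotal λ x → Cover A x × NonNegative A x

  InCommonAllOnes : (e f : Fin n × Fin m) → Set
  InCommonAllOnes (i , j) (i′ , j′) = ∃₂ λ U V →
    AllOnes A U V × (i ∈ U × j ∈ V) × (i′ ∈ U × j′ ∈ V)

  IsIsolationSet : List (Fin n × Fin m) → Set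
  IsIsolationSet S =
      Unique S
    × (∀ {i j} → (i , j) ∈ˡ S → A i j ≡ true)
    × (∀ {e f} → e ∈ˡ S → f ∈ˡ S → e ≢ f → ¬ InCommonAllOnes e f)

  Is-i : ℕ → Set
  Is-i s =
      (∃ λ S → IsIsolationSet S × length S ≡ s)
    × (∀ S → IsIsolationSet S → length S ℕ.≤ s)

Is-bpf∞ : ∀ {n m} → BinMatrix n m → ℝ → Set
Is-bpf∞ A L = ∃ λ (ρ : ℕ → ℝ) →
    (∀ k → .{{ℕ.NonZero k}} → ∃ λ v → Is-bpf (A ^⊗ k) v × IsRoot k v (ρ k))
  × ρ ⟶ L

module Submission where

-- Every argument takes place in ℚ; real weight vectors are replaced by nearby rational ones.
--
-- Upper bounds: the product of fractional partitions of A and B is a fractional partition of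
-- A ⊗ B whose total is the product of the totals, so bpf∞ A ≤ bpf A.  For the domino D the same
-- applies to D^⊗5, where averaging 34 bicliques and their transposes over the symmetries of the
-- power gives a fractional partition of total less than 75.2014 < 2.372713⁵.
--
-- Lower bounds: given a cover of A ⊗ B, its slices at the one-entries of B cover A.  Hence the
-- projections of its rectangles to B cover every one-entry of B at least bcf A times, and bcf is
-- supermultiplicative; this needs no linear programming duality.  Every fractional partition is
-- a cover, and distinct entries of an isolation set are covered by disjoint sets of bicliques.

open import Defs
open import Algebra.Bundles using (CommutativeRing)
open import Data.Bool.Base as Bool using (Bool; true; false; _∧_; _∨_; if_then_else_)
import Data.Bool.Properties as Bool
open import Data.Empty using (⊥-elim)
open import Data.Fin.Base using (Fin; zero; suc; quotient; remainder; combine)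
open import Data.Fin.Patterns using (0F; 1F; 2F)
import Data.Fin.Properties as Fin
open import Data.Fin.Properties using (any?; remQuot-combine)
open import Data.Fin.Subset using (Subset; _∈_; inside; outside)
open import Data.Fin.Subset.Properties using (_∈?_)
open import Data.Integer.Base as ℤ using (+_)
import Data.Integer.Properties as ℤ
open import Data.List.Base as List
  using (List; []; _∷_; _++_; allFin; cartesianProduct; length)
open import Data.List.Membership.Propositional using () renaming (_∈_ to _∈ˡ_)
open import Data.List.Membership.Propositional.Properties
  using (∈-filter⁺; ∈-filter⁻; ∈-cartesianProduct⁺; ∈-cartesianProductWith⁺; ∈-lookup)
import Data.List.Properties as List
import Data.List.Relation.Unary.All as All
open import Data.List.Relation.Unary.All using ([]; _∷_)
open import Data.List.Relation.Unary.AllPairs using ([]; _∷_)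
open import Data.List.Relation.Unary.Any using (here; there; index)
import Data.List.Relation.Unary.Any.Properties as Any
open import Data.List.Relation.Unary.Unique.Propositional using (Unique)
open import Data.Nat.Base as ℕ using (ℕ)
import Data.Nat.Properties as ℕ
open import Data.Product.Base using (∃; _×_; _,_; proj₁; proj₂)
open import Data.Rational.Base as ℚ using (ℚ; 0ℚ; 1ℚ; ½; ∣_∣)
open import Data.Rational.Base using (_/_)
import Data.Rational.Properties as ℚ
import Data.Rational.Solver as ℚSolver
import Data.Rational.Unnormalised.Base as ℚᵘ
import Data.Rational.Unnormalised.Properties as ℚᵘ
open import Data.Sum.Base as Sum using (_⊎_; inj₁; inj₂)
open import Data.Unit.Base using (⊤; tt)
open import Data.Vec.Base as Vec using (Vec; []; _∷_; zipWith; insertAt)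
import Data.Vec.Properties as Vec
open import Function.Base using (_∘_; id)
open import Relation.Binary.PropositionalEquality
open import Relation.Nullary.Decidable.Core using (Dec; does; yes; no)
open import Relation.Nullary.Negation.Core using (¬_)

open import Algebra.Definitions.RawSemiring ℚ.+-*-rawSemiring
  using () renaming (_^_ to _^ℚ_)
import Algebra.Properties.CommutativeSemiring.Exp
  (CommutativeRing.commutativeSemiring ℚ.+-*-commutativeRing) as Exp

-- Two obstacles shape the passage between ℝ and ℚ. The terms of a nonnegative real may be negative,
-- so weights are shifted up by a small `η`; and `Mx = 1` holds for late terms only up to an error.
-- For covers the error is absorbed by the level `t` in `LowerBound`. For partitions no rescaling
-- repairs uneven errors, so missing coverage is first filled in by singletons. Tails are
-- double-negated and yield no index, but an inequality of reals is itself a negation for each `ε`,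
-- so while proving one an index may be assumed given. The fifth power of the domino has 7⁵
-- one-entries. Summing over flips reduces them to words in four classes, and the sum over
-- permutations is computed by inserting one letter at a time into a table. What remains is an
-- evaluation on natural numbers, small enough for `refl`.

p+q-q≡p : ∀ p q → p ℚ.+ q ℚ.- q ≡ p
p+q-q≡p = solve 2 (λ p q → p :+ q :- q := p) refl
  where open ℚSolver.+-*-Solver

0≤1 : 0ℚ ℚ.≤ 1ℚ
0≤1 = ℚ.nonNegative⁻¹ 1ℚ

*-mono-≤ : ∀ {p q r s} → 0ℚ ℚ.≤ r → 0ℚ ℚ.≤ q → p ℚ.≤ q → r ℚ.≤ s → p ℚ.* r ℚ.≤ q ℚ.* s
*-mono-≤ {q = q} {r = r} r≥0 q≥0 p≤q r≤s = ℚ.≤-trans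
  (ℚ.*-monoʳ-≤-nonNeg r {{ℚ.nonNegative r≥0}} p≤q)
  (ℚ.*-monoˡ-≤-nonNeg q {{ℚ.nonNegative q≥0}} r≤s)

*-nonNeg : ∀ {p q} → 0ℚ ℚ.≤ p → 0ℚ ℚ.≤ q → 0ℚ ℚ.≤ p ℚ.* q
*-nonNeg {p} {q} p≥0 q≥0 = subst (ℚ._≤ p ℚ.* q) (ℚ.*-zeroˡ q)
  (ℚ.*-monoʳ-≤-nonNeg q {{ℚ.nonNegative q≥0}} p≥0)

+-nonNeg : ∀ {p q} → 0ℚ ℚ.≤ p → 0ℚ ℚ.≤ q → 0ℚ ℚ.≤ p ℚ.+ q
+-nonNeg {p} {q} p≥0 q≥0 = subst (ℚ._≤ p ℚ.+ q) (ℚ.+-identityˡ 0ℚ) (ℚ.+-mono-≤ p≥0 q≥0)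

^-nonNeg : ∀ {p} k → 0ℚ ℚ.≤ p → 0ℚ ℚ.≤ p ^ℚ k
^-nonNeg ℕ.zero    p≥0 = 0≤1
^-nonNeg (ℕ.suc k) p≥0 = *-nonNeg p≥0 (^-nonNeg k p≥0)

-- Finite sums of rationals and natural numbers inside ℚ

∑ : {X : Set} → List X → (X → ℚ) → ℚ
∑ []       f = 0ℚ
∑ (x ∷ xs) f = f x ℚ.+ ∑ xs f

module _ {X : Set} where

  ∑-cong : ∀ xs {f g : X → ℚ} → (∀ x → f x ≡ g x) → ∑ xs f ≡ ∑ xs g
  ∑-cong []       eq = refl
  ∑-cong (x ∷ xs) eq = cong₂ ℚ._+_ (eq x) (∑-cong xs eq)

  ∑-mono : ∀ xs {f g : X → ℚ} → (∀ x → f x ℚ.≤ g x) → ∑ xs f ℚ.≤ ∑ xs g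
  ∑-mono []       le = ℚ.≤-refl
  ∑-mono (x ∷ xs) le = ℚ.+-mono-≤ (le x) (∑-mono xs le)

  ∑-nonNeg : ∀ xs {f : X → ℚ} → (∀ x → 0ℚ ℚ.≤ f x) → 0ℚ ℚ.≤ ∑ xs f
  ∑-nonNeg []       le = ℚ.≤-refl
  ∑-nonNeg (x ∷ xs) le = +-nonNeg (le x) (∑-nonNeg xs le)

  ∑-++ : ∀ xs ys {f : X → ℚ} → ∑ (xs ++ ys) f ≡ ∑ xs f ℚ.+ ∑ ys f
  ∑-++ []       ys = sym (ℚ.+-identityˡ _)
  ∑-++ (x ∷ xs) ys {f} = trans (cong (f x ℚ.+_) (∑-++ xs ys)) (sym (ℚ.+-assoc (f x) _ _))

  ∑-map : ∀ {Y : Set} (g : Y → X) ys {f : X → ℚ} → ∑ (List.map g ys) f ≡ ∑ ys (f ∘ g)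
  ∑-map g []       = refl
  ∑-map g (y ∷ ys) {f} = cong (f (g y) ℚ.+_) (∑-map g ys)

  ∑-*ˡ : ∀ xs c {f : X → ℚ} → ∑ xs (λ x → c ℚ.* f x) ≡ c ℚ.* ∑ xs f
  ∑-*ˡ []       c = sym (ℚ.*-zeroʳ c)
  ∑-*ˡ (x ∷ xs) c {f} =
    trans (cong (c ℚ.* f x ℚ.+_) (∑-*ˡ xs c)) (sym (ℚ.*-distribˡ-+ c (f x) _))

  ∑-*ʳ : ∀ xs c {f : X → ℚ} → ∑ xs (λ x → f x ℚ.* c) ≡ ∑ xs f ℚ.* c
  ∑-*ʳ xs c {f} = trans (∑-cong xs λ x → ℚ.*-comm (f x) c) (trans (∑-*ˡ xs c) (ℚ.*-comm c _))

  ∑-+ : ∀ xs {f g : X → ℚ} → ∑ xs (λ x → f x ℚ.+ g x) ≡ ∑ xs f ℚ.+ ∑ xs g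
  ∑-+ []       = sym (ℚ.+-identityˡ 0ℚ)
  ∑-+ (x ∷ xs) {f} {g} = trans (cong (f x ℚ.+ g x ℚ.+_) (∑-+ xs)) (interchange (f x) (g x) _ _)
    where
    open ℚSolver.+-*-Solver
    interchange : ∀ a b c d → a ℚ.+ b ℚ.+ (c ℚ.+ d) ≡ a ℚ.+ c ℚ.+ (b ℚ.+ d)
    interchange = solve 4 (λ a b c d → a :+ b :+ (c :+ d) := a :+ c :+ (b :+ d)) refl

  ∑-0 : ∀ xs → ∑ {X} xs (λ _ → 0ℚ) ≡ 0ℚ
  ∑-0 []       = refl
  ∑-0 (x ∷ xs) = trans (ℚ.+-identityˡ _) (∑-0 xs)

∑-swap : ∀ {X Y : Set} (xs : List X) (ys : List Y) {f : X → Y → ℚ} →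
         ∑ xs (λ x → ∑ ys (f x)) ≡ ∑ ys (λ y → ∑ xs (λ x → f x y))
∑-swap []       ys = sym (∑-0 ys)
∑-swap (x ∷ xs) ys {f} = trans (cong (∑ ys (f x) ℚ.+_) (∑-swap xs ys)) (sym (∑-+ ys))

∑-cartesianProduct : ∀ {X Y : Set} (xs : List X) (ys : List Y) {f : X × Y → ℚ} →
                     ∑ (cartesianProduct xs ys) f ≡ ∑ xs (λ x → ∑ ys (λ y → f (x , y)))
∑-cartesianProduct []       ys = refl
∑-cartesianProduct (x ∷ xs) ys =
  trans (∑-++ (List.map (x ,_) ys) (cartesianProduct xs ys))
        (cong₂ ℚ._+_ (∑-map (x ,_) ys) (∑-cartesianProduct xs ys))

𝟙[_] : Bool → ℚ
𝟙[ b ] = if b then 1ℚ else 0ℚ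

𝟙-nonNeg : ∀ b → 0ℚ ℚ.≤ 𝟙[ b ]
𝟙-nonNeg true  = 0≤1
𝟙-nonNeg false = ℚ.≤-refl

𝟙≤1 : ∀ b → 𝟙[ b ] ℚ.≤ 1ℚ
𝟙≤1 true  = ℚ.≤-refl
𝟙≤1 false = 0≤1

𝟙-∧ : ∀ a b → 𝟙[ a ∧ b ] ≡ 𝟙[ a ] ℚ.* 𝟙[ b ]
𝟙-∧ true  b = sym (ℚ.*-identityˡ 𝟙[ b ])
𝟙-∧ false b = sym (ℚ.*-zeroˡ 𝟙[ b ])

∧-true⁻ : ∀ {a b} → a ∧ b ≡ true → a ≡ true × b ≡ true
∧-true⁻ {true} eq = refl , eq

∧-true⁺ : ∀ {a b} → a ≡ true → b ≡ true → a ∧ b ≡ true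
∧-true⁺ refl refl = refl

ι : ℕ → ℚ
ι n = ℤ.+ n ℚ./ 1

-- `ℚ./` divides by a gcd, which does not reduce on variables. Identities for `ι` are therefore
-- proved for unnormalised fractions and carried back.
toℚᵘ-/ : ∀ i n .{{_ : ℕ.NonZero n}} → ℚ.toℚᵘ (i ℚ./ n) ℚᵘ.≃ (i ℚᵘ./ n)
toℚᵘ-/ i (ℕ.suc d) = ℚ.toℚᵘ-fromℚᵘ (ℚᵘ.mkℚᵘ i d)

ι-+ : ∀ m n → ι (m ℕ.+ n) ≡ ι m ℚ.+ ι n
ι-+ m n = ℚ.toℚᵘ-injective (begin
  ℚ.toℚᵘ (ι (m ℕ.+ n))                 ≈⟨ toℚᵘ-/ _ 1 ⟩
  ℤ.+ (m ℕ.+ n) ℚᵘ./ 1                   ≈⟨ ℚᵘ.*≡* (cong (ℤ._* ℤ.+ 1) (cong₂ ℤ._+_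
                                            (sym (ℤ.*-identityʳ (ℤ.+ m))) (sym (ℤ.*-identityʳ (ℤ.+ n))))) ⟩
  (ℤ.+ m ℚᵘ./ 1) ℚᵘ.+ (ℤ.+ n ℚᵘ./ 1)       ≈⟨ ℚᵘ.+-cong (toℚᵘ-/ (ℤ.+ m) 1) (toℚᵘ-/ (ℤ.+ n) 1) ⟨
  ℚ.toℚᵘ (ι m) ℚᵘ.+ ℚ.toℚᵘ (ι n)       ≈⟨ ℚ.toℚᵘ-homo-+ (ι m) (ι n) ⟨
  ℚ.toℚᵘ (ι m ℚ.+ ι n)                   ∎)
  where open ℚᵘ.≃-Reasoning

ι-* : ∀ m n → ι (m ℕ.* n) ≡ ι m ℚ.* ι n
ι-* m n = ℚ.toℚᵘ-injective (begin
  ℚ.toℚᵘ (ι (m ℕ.* n))                 ≈⟨ toℚᵘ-/ _ 1 ⟩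
  ℤ.+ (m ℕ.* n) ℚᵘ./ 1                   ≈⟨ ℚᵘ.*≡* (cong (ℤ._* ℤ.+ 1) (ℤ.pos-* m n)) ⟩
  (ℤ.+ m ℚᵘ./ 1) ℚᵘ.* (ℤ.+ n ℚᵘ./ 1)       ≈⟨ ℚᵘ.*-cong (toℚᵘ-/ (ℤ.+ m) 1) (toℚᵘ-/ (ℤ.+ n) 1) ⟨
  ℚ.toℚᵘ (ι m) ℚᵘ.* ℚ.toℚᵘ (ι n)       ≈⟨ ℚ.toℚᵘ-homo-* (ι m) (ι n) ⟨
  ℚ.toℚᵘ (ι m ℚ.* ι n)                   ∎)
  where open ℚᵘ.≃-Reasoning

ι-/ : ∀ m n .{{_ : ℕ.NonZero n}} → ι n ℚ.* (ℤ.+ m ℚ./ n) ≡ ι m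
ι-/ m n@(ℕ.suc d) = ℚ.toℚᵘ-injective (begin
  ℚ.toℚᵘ (ι n ℚ.* (ℤ.+ m ℚ./ n))           ≈⟨ ℚ.toℚᵘ-homo-* (ι n) (ℤ.+ m ℚ./ n) ⟩
  ℚ.toℚᵘ (ι n) ℚᵘ.* ℚ.toℚᵘ (ℤ.+ m ℚ./ n) ≈⟨ ℚᵘ.*-cong (toℚᵘ-/ (ℤ.+ n) 1) (toℚᵘ-/ (ℤ.+ m) n) ⟩
  (ℤ.+ n ℚᵘ./ 1) ℚᵘ.* (ℤ.+ m ℚᵘ./ n)       ≈⟨ ℚᵘ.*≡* (trans (ℤ.*-identityʳ _) (trans (ℤ.*-comm (ℤ.+ n) (ℤ.+ m))
                                                (cong (ℤ.+ m ℤ.*_) (sym (ℤ.*-identityˡ (ℤ.+ n)))))) ⟩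
  ℤ.+ m ℚᵘ./ 1                           ≈⟨ toℚᵘ-/ (ℤ.+ m) 1 ⟨
  ℚ.toℚᵘ (ι m)                         ∎)
  where open ℚᵘ.≃-Reasoning

ι-mono : ∀ {m n} → m ℕ.≤ n → ι m ℚ.≤ ι n
ι-mono {m} {n} m≤n = ℚ.toℚᵘ-cancel-≤
  (ℚᵘ.≤-respˡ-≃ (ℚᵘ.≃-sym (toℚᵘ-/ (ℤ.+ m) 1)) (ℚᵘ.≤-respʳ-≃ (ℚᵘ.≃-sym (toℚᵘ-/ (ℤ.+ n) 1))
    (ℚᵘ.*≤* (ℤ.*-monoʳ-≤-nonNeg (ℤ.+ 1) (ℤ.+≤+ m≤n)))))

ι≥0 : ∀ n → 0ℚ ℚ.≤ ι n
ι≥0 n = ι-mono {0} {n} ℕ.z≤n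

∑-allFin : ∀ k (f : Fin (ℕ.suc k) → ℚ) →
           ∑ (allFin (ℕ.suc k)) f ≡ f zero ℚ.+ ∑ (allFin k) (f ∘ suc)
∑-allFin k f = cong (f zero ℚ.+_)
  (trans (cong (λ ps → ∑ ps f) (sym (List.map-tabulate (λ p → p) suc))) (∑-map suc (allFin k)))

∑-const : ∀ {X : Set} (xs : List X) c → ∑ xs (λ _ → c) ≡ ι (length xs) ℚ.* c
∑-const []       c = sym (ℚ.*-zeroˡ c)
∑-const (x ∷ xs) c = begin
  c ℚ.+ ∑ xs (λ _ → c)               ≡⟨ cong₂ ℚ._+_ (sym (ℚ.*-identityˡ c)) (∑-const xs c) ⟩
  1ℚ ℚ.* c ℚ.+ ι (length xs) ℚ.* c   ≡⟨ ℚ.*-distribʳ-+ c 1ℚ (ι (length xs)) ⟨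
  (1ℚ ℚ.+ ι (length xs)) ℚ.* c       ≡⟨ cong (ℚ._* c) (ι-+ 1 (length xs)) ⟨
  ι (length (x ∷ xs)) ℚ.* c          ∎
  where open ≡-Reasoning

∑-mono-∈ : ∀ {X : Set} (xs : List X) {f g : X → ℚ} → (∀ {x} → x ∈ˡ xs → f x ℚ.≤ g x) →
           ∑ xs f ℚ.≤ ∑ xs g
∑-mono-∈ []       le = ℚ.≤-refl
∑-mono-∈ (x ∷ xs) le = ℚ.+-mono-≤ (le (here refl)) (∑-mono-∈ xs (le ∘ there))

∑-δ : ∀ {n} (f : Fin n → ℚ) i → ∑ (allFin n) (λ a → f a ℚ.* 𝟙[ does (i Fin.≟ a) ]) ≡ f i
∑-δ {ℕ.suc n} f zero = begin
  ∑ (allFin (ℕ.suc n)) (λ a → f a ℚ.* 𝟙[ does (zero Fin.≟ a) ])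
    ≡⟨ ∑-allFin n (λ a → f a ℚ.* 𝟙[ does (zero Fin.≟ a) ]) ⟩
  f zero ℚ.* 1ℚ ℚ.+ ∑ (allFin n) (λ a → f (suc a) ℚ.* 0ℚ)
    ≡⟨ cong₂ ℚ._+_ (ℚ.*-identityʳ (f zero))
         (trans (∑-cong (allFin n) λ a → ℚ.*-zeroʳ (f (suc a))) (∑-0 (allFin n))) ⟩
  f zero ℚ.+ 0ℚ
    ≡⟨ ℚ.+-identityʳ (f zero) ⟩
  f zero ∎
  where open ≡-Reasoning
∑-δ {ℕ.suc n} f (suc i) = begin
  ∑ (allFin (ℕ.suc n)) (λ a → f a ℚ.* 𝟙[ does (suc i Fin.≟ a) ])
    ≡⟨ ∑-allFin n (λ a → f a ℚ.* 𝟙[ does (suc i Fin.≟ a) ]) ⟩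
  f zero ℚ.* 0ℚ ℚ.+ ∑ (allFin n) (λ a → f (suc a) ℚ.* 𝟙[ does (i Fin.≟ a) ])
    ≡⟨ cong₂ ℚ._+_ (ℚ.*-zeroʳ (f zero)) (∑-δ (f ∘ suc) i) ⟩
  0ℚ ℚ.+ f (suc i)
    ≡⟨ ℚ.+-identityˡ (f (suc i)) ⟩
  f (suc i) ∎
  where open ≡-Reasoning

∑-allFin-const : ∀ N c → ∑ (allFin N) (λ _ → c) ≡ ι N ℚ.* c
∑-allFin-const N c = trans (∑-const (allFin N) c)
  (cong (λ l → ι l ℚ.* c) (List.length-tabulate {n = N} id))

-- A second hit behind a head that satisfies `P` contradicts uniqueness. That case only has to be
-- refuted, so the doubly negated `¬ x ≢ y`, which is what an isolation set provides, suffices.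
∑-𝟙≤1 : ∀ {X : Set} (xs : List X) (P : X → Bool) → Unique xs →
        (∀ {x y} → x ∈ˡ xs → y ∈ˡ xs → P x ≡ true → P y ≡ true → ¬ x ≢ y) →
        ∑ xs (λ x → 𝟙[ P x ]) ℚ.≤ 1ℚ
∑-𝟙≤1 []       P []            atMostOne = 0≤1
∑-𝟙≤1 (x ∷ xs) P (x∉xs ∷ uniq) atMostOne = cases (P x) refl
  where
  cases : ∀ b → P x ≡ b → 𝟙[ b ] ℚ.+ ∑ xs (λ y → 𝟙[ P y ]) ℚ.≤ 1ℚ
  cases false _ = subst (ℚ._≤ 1ℚ) (sym (ℚ.+-identityˡ _))
    (∑-𝟙≤1 xs P uniq λ x∈ y∈ → atMostOne (there x∈) (there y∈))
  cases true  Px = ℚ.+-monoʳ-≤ 1ℚ (subst (∑ xs (λ y → 𝟙[ P y ]) ℚ.≤_) (∑-0 xs)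
    (∑-mono-∈ xs λ {y} y∈ → none y∈ (P y) refl))
    where
    none : ∀ {y} → y ∈ˡ xs → ∀ b → P y ≡ b → 𝟙[ b ] ℚ.≤ 0ℚ
    none y∈ false _  = ℚ.≤-refl
    none y∈ true  Py = ⊥-elim (atMostOne (here refl) (there y∈) Px Py (All.lookup x∉xs y∈))

-- Weighted families of rectangles

-- Unlike bicliques, the rectangles of a family may be empty.
record Family {I J : Set} (A : I → J → Bool) : Set₁ where
  field
    {Index}  : Set
    indices  : List Index
    weight   : Index → ℚ
    rows     : Index → I → Bool
    cols     : Index → J → Bool
    weight≥0 : ∀ x → 0ℚ ℚ.≤ weight x
    allOnes  : ∀ x i j → rows x i ≡ true → cols x j ≡ true → A i j ≡ true

  total : ℚ
  total = ∑ indices weight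

  total≥0 : 0ℚ ℚ.≤ total
  total≥0 = ∑-nonNeg indices weight≥0

  coverage : I → J → ℚ
  coverage i j = ∑ indices λ x → weight x ℚ.* 𝟙[ rows x i ∧ cols x j ]

  coverage≤total : ∀ i j → coverage i j ℚ.≤ total
  coverage≤total i j = ∑-mono indices λ x →
    subst (weight x ℚ.* 𝟙[ rows x i ∧ cols x j ] ℚ.≤_) (ℚ.*-identityʳ (weight x))
      (ℚ.*-monoˡ-≤-nonNeg (weight x) {{ℚ.nonNegative (weight≥0 x)}} (𝟙≤1 (rows x i ∧ cols x j)))

open Family

module _ {I J : Set} {A : I → J → Bool} where

  scale : ∀ c → 0ℚ ℚ.≤ c → Family A → Family A
  scale c c≥0 F = record
    { indices  = indices F
    ; weight   = λ x → c ℚ.* weight F x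
    ; rows     = rows F
    ; cols     = cols F
    ; weight≥0 = λ x → *-nonNeg c≥0 (weight≥0 F x)
    ; allOnes  = allOnes F
    }

  total-scale : ∀ c c≥0 F → total (scale c c≥0 F) ≡ c ℚ.* total F
  total-scale c c≥0 F = ∑-*ˡ (indices F) c

  coverage-scale : ∀ c c≥0 F i j → coverage (scale c c≥0 F) i j ≡ c ℚ.* coverage F i j
  coverage-scale c c≥0 F i j =
    trans (∑-cong (indices F) λ x → ℚ.*-assoc c (weight F x) 𝟙[ rows F x i ∧ cols F x j ])
          (∑-*ˡ (indices F) c)

PartitionOf : ∀ {I J : Set} (A : I → J → Bool) → ℚ → Set₁
PartitionOf A t = ∃ λ (F : Family A) →
  (∀ i j → A i j ≡ true → coverage F i j ≡ 1ℚ) × total F ≡ t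

-- Products of families and partitions of Kronecker powers

module _ {I J I₁ J₁ I₂ J₂ : Set} {A : I₁ → J₁ → Bool} {B : I₂ → J₂ → Bool}
         (f₁ : I → I₁) (g₁ : J → J₁) (f₂ : I → I₂) (g₂ : J → J₂) where

  private
    A×B : I → J → Bool
    A×B i j = A (f₁ i) (g₁ j) ∧ B (f₂ i) (g₂ j)

  -- The Kronecker product of rank-one matrices has rank one. The coordinate maps are parameters so
  -- that one construction serves both `quotient` with `remainder` and `digits` with `rest`.
  product : Family A → Family B → Family A×B
  product F G = record
    { indices  = cartesianProduct (indices F) (indices G)
    ; weight   = λ (x , y) → weight F x ℚ.* weight G y
    ; rows     = λ (x , y) i → rows F x (f₁ i) ∧ rows G y (f₂ i)
    ; cols     = λ (x , y) j → cols F x (g₁ j) ∧ cols G y (g₂ j)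
    ; weight≥0 = λ (x , y) → *-nonNeg (weight≥0 F x) (weight≥0 G y)
    ; allOnes  = λ (x , y) i j r c →
        let r₁ , r₂ = ∧-true⁻ r
            c₁ , c₂ = ∧-true⁻ c
        in ∧-true⁺ (allOnes F x _ _ r₁ c₁) (allOnes G y _ _ r₂ c₂)
    }

  private
    ∑∑-* : ∀ {X Y : Set} (xs : List X) (ys : List Y) {f : X → ℚ} {g : Y → ℚ} →
           ∑ xs (λ x → ∑ ys (λ y → f x ℚ.* g y)) ≡ ∑ xs f ℚ.* ∑ ys g
    ∑∑-* xs ys {f} {g} = trans (∑-cong xs λ x → ∑-*ˡ ys (f x)) (∑-*ʳ xs (∑ ys g))

    regroup : ∀ p q a b c d →
              p ℚ.* q ℚ.* 𝟙[ (a ∧ b) ∧ (c ∧ d) ] ≡ p ℚ.* 𝟙[ a ∧ c ] ℚ.* (q ℚ.* 𝟙[ b ∧ d ])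
    regroup p q a b c d
      rewrite 𝟙-∧ (a ∧ b) (c ∧ d) | 𝟙-∧ a b | 𝟙-∧ c d | 𝟙-∧ a c | 𝟙-∧ b d =
      solve 6 (λ p q a b c d →
        p :* q :* ((a :* b) :* (c :* d)) := p :* (a :* c) :* (q :* (b :* d))) refl
        p q 𝟙[ a ] 𝟙[ b ] 𝟙[ c ] 𝟙[ d ]
      where open ℚSolver.+-*-Solver

  total-product : ∀ F G → total (product F G) ≡ total F ℚ.* total G
  total-product F G =
    trans (∑-cartesianProduct (indices F) (indices G)) (∑∑-* (indices F) (indices G))

  coverage-product : ∀ F G i j →
    coverage (product F G) i j ≡ coverage F (f₁ i) (g₁ j) ℚ.* coverage G (f₂ i) (g₂ j)
  coverage-product F G i j =
    trans (∑-cartesianProduct (indices F) (indices G))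
   (trans (∑-cong (indices F) λ x → ∑-cong (indices G) λ y →
             regroup (weight F x) (weight G y) (rows F x (f₁ i)) (rows G y (f₂ i))
               (cols F x (g₁ j)) (cols G y (g₂ j)))
          (∑∑-* (indices F) (indices G)))

  product-partition : ∀ {s t} → PartitionOf A s → PartitionOf B t → PartitionOf A×B (s ℚ.* t)
  product-partition (F , pF , tF) (G , pG , tG) =
      product F G
    , (λ i j AB → let a , b = ∧-true⁻ {A (f₁ i) (g₁ j)} AB in
         trans (coverage-product F G i j) (cong₂ ℚ._*_ (pF _ _ a) (pG _ _ b)))
    , trans (total-product F G) (cong₂ ℚ._*_ tF tG)

unitFamily : ∀ {I J : Set} → Family {I} {J} (λ _ _ → true)
unitFamily = record
  { indices  = tt ∷ []
  ; weight   = λ _ → 1ℚ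
  ; rows     = λ _ _ → true
  ; cols     = λ _ _ → true
  ; weight≥0 = λ _ → 0≤1
  ; allOnes  = λ _ _ _ _ _ → refl
  }

power-partition : ∀ {n m} {A : BinMatrix n m} {t} → PartitionOf A t →
                  ∀ k → PartitionOf (A ^⊗ k) (t ^ℚ k)
power-partition P ℕ.zero = unitFamily , (λ _ _ _ → refl) , refl
power-partition {n} {m} P (ℕ.suc k) =
  product-partition (quotient (n ℕ.^ k)) (quotient (m ℕ.^ k))
    (remainder {n} (n ℕ.^ k)) (remainder {m} (m ℕ.^ k)) P (power-partition P k)

-- Stated for covers of any level t, because slices of a cover of A ⊗ B lead to such covers.
LowerBound : ∀ {I J : Set} → (I → J → Bool) → ℚ → Set₁
LowerBound A q = ∀ (F : Family A) t → 0ℚ ℚ.≤ t →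
  (∀ i j → A i j ≡ true → t ℚ.≤ coverage F i j) → t ℚ.* q ℚ.≤ total F

-- Slices, projections and supermultiplicativity

module _ {n m p q} {A : BinMatrix n m} {B : BinMatrix p q} (F : Family (A ⊗ B)) where

  private
    -- The projection to `Fin l` of a subset of `Fin k × Fin l` encoded by `combine`.
    hits : ∀ k {l} → (Fin (k ℕ.* l) → Bool) → Fin l → Bool
    hits k u b = does (any? λ (a : Fin k) → u (combine a b) Bool.≟ true)

    hits⁺ : ∀ k {l} (u : Fin (k ℕ.* l) → Bool) (a : Fin k) b → u (combine a b) ≡ true →
            hits k u b ≡ true
    hits⁺ k u a b eq with any? (λ (a : Fin k) → u (combine a b) Bool.≟ true)
    ... | yes _ = refl
    ... | no ¬p = ⊥-elim (¬p (a , eq))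

    hits⁻ : ∀ k {l} (u : Fin (k ℕ.* l) → Bool) b → hits k u b ≡ true →
            ∃ λ (a : Fin k) → u (combine a b) ≡ true
    hits⁻ k u b eq with any? (λ (a : Fin k) → u (combine a b) Bool.≟ true)
    ... | yes r = r

    ⊗-combine : ∀ i i′ j j′ → (A ⊗ B) (combine i i′) (combine j j′) ≡ A i j ∧ B i′ j′
    ⊗-combine i i′ j j′ = cong₂ (λ r c → A (proj₁ r) (proj₁ c) ∧ B (proj₂ r) (proj₂ c))
      (remQuot-combine {n} i i′) (remQuot-combine {m} j j′)

  slice : Fin p → Fin q → Family A
  slice i′ j′ = record
    { indices  = indices F
    -- The indicator removes the rectangles whose slice is empty. With it, the total of the slice is
    -- definitionally the coverage of `(i′ , j′)` by `projection`.
    ; weight   = λ x → weight F x ℚ.* 𝟙[ hits n (rows F x) i′ ∧ hits m (cols F x) j′ ]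
    ; rows     = λ x i → rows F x (combine i i′)
    ; cols     = λ x j → cols F x (combine j j′)
    ; weight≥0 = λ x → *-nonNeg (weight≥0 F x) (𝟙-nonNeg _)
    ; allOnes  = λ x i j r c →
        proj₁ (∧-true⁻ (trans (sym (⊗-combine i i′ j j′)) (allOnes F x _ _ r c)))
    }

  -- A rectangle is a product set, so witnesses above a projected row and above a projected column
  -- can be chosen independently and still meet in a one of `A ⊗ B`.
  projection : Family B
  projection = record
    { indices  = indices F
    ; weight   = weight F
    ; rows     = λ x → hits n (rows F x)
    ; cols     = λ x → hits m (cols F x)
    ; weight≥0 = weight≥0 F
    ; allOnes  = λ x i′ j′ r c →
        let i , r′ = hits⁻ n (rows F x) i′ r
            j , c′ = hits⁻ m (cols F x) j′ c
        in proj₂ (∧-true⁻ {A i j} (trans (sym (⊗-combine i i′ j j′)) (allOnes F x _ _ r′ c′)))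
    }

  -- The indicator in the weight is harmless: a rectangle that contains the combined entry hits row
  -- `i′` and column `j′`.
  coverage-slice : ∀ i j i′ j′ →
    coverage (slice i′ j′) i j ≡ coverage F (combine i i′) (combine j j′)
  coverage-slice i j i′ j′ = ∑-cong (indices F) λ x →
    absorb x (rows F x (combine i i′)) (cols F x (combine j j′)) refl refl
    where
    w = weight (slice i′ j′)
    absorb : ∀ x r c → rows F x (combine i i′) ≡ r → cols F x (combine j j′) ≡ c →
      w x ℚ.* 𝟙[ r ∧ c ] ≡ weight F x ℚ.* 𝟙[ r ∧ c ]
    absorb x false c     eqr eqc = trans (ℚ.*-zeroʳ (w x)) (sym (ℚ.*-zeroʳ (weight F x)))
    absorb x true  false eqr eqc = trans (ℚ.*-zeroʳ (w x)) (sym (ℚ.*-zeroʳ (weight F x)))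
    absorb x true  true  eqr eqc
      rewrite hits⁺ n (rows F x) i i′ eqr | hits⁺ m (cols F x) j j′ eqc =
        ℚ.*-identityʳ (weight F x ℚ.* 1ℚ)

  -- The slice at a one-entry (i′ , j′) of B covers A, and its total is the coverage of
  -- (i′ , j′) by the projection.  So the projection covers B with a factor a.
  ⊗-total : ∀ {a b t} → 0ℚ ℚ.≤ a → 0ℚ ℚ.≤ t → LowerBound A a → LowerBound B b →
    (∀ i j → (A ⊗ B) i j ≡ true → t ℚ.≤ coverage F i j) → t ℚ.* (a ℚ.* b) ℚ.≤ total F
  ⊗-total {a} {b} {t} a≥0 t≥0 lbA lbB cov =
    subst (ℚ._≤ total F) (ℚ.*-assoc t a b)
      (lbB projection (t ℚ.* a) (*-nonNeg t≥0 a≥0) λ i′ j′ Bij → lbA (slice i′ j′) t t≥0 λ i j Aij →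
        subst (t ℚ.≤_) (sym (coverage-slice i j i′ j′))
          (cov _ _ (trans (⊗-combine i i′ j j′) (∧-true⁺ Aij Bij))))

-- At exponent zero the matrix is a single one, whose coverage is at most the total; each further
-- factor is an instance of `⊗-total`.
power-lowerBound : ∀ {n m} {A : BinMatrix n m} {a} → 0ℚ ℚ.≤ a → LowerBound A a →
                   ∀ k → LowerBound (A ^⊗ k) (a ^ℚ k)
power-lowerBound a≥0 lb ℕ.zero F t t≥0 cov =
  subst (ℚ._≤ total F) (sym (ℚ.*-identityʳ t))
    (ℚ.≤-trans (cov zero zero refl) (coverage≤total F zero zero))
power-lowerBound a≥0 lb (ℕ.suc k) F t t≥0 cov =
  ⊗-total F a≥0 t≥0 lb (power-lowerBound a≥0 lb k) cov

-- The certificate for the domino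

PartitionOf-resp : ∀ {I J : Set} {A B : I → J → Bool} {t} →
                   (∀ i j → A i j ≡ B i j) → PartitionOf A t → PartitionOf B t
PartitionOf-resp A≡B (F , pF , tF) = record
  { indices  = indices F
  ; weight   = weight F
  ; rows     = rows F
  ; cols     = cols F
  ; weight≥0 = weight≥0 F
  ; allOnes  = λ x i j r c → trans (sym (A≡B i j)) (allOnes F x i j r c)
  } , (λ i j Bij → pF i j (trans (A≡B i j) Bij)) , tF

-- Entries of the `k`-th Kronecker power with positions written as words, so that permuting the
-- factors is permuting letters.
onWords : ∀ {n m k} → BinMatrix n m → Vec (Fin n) k → Vec (Fin m) k → Bool
onWords A []       []       = true
onWords A (i ∷ is) (j ∷ js) = A i j ∧ onWords A is js

module _ {n : ℕ} where

  digits : ∀ k l → Fin (n ℕ.^ (k ℕ.+ l)) → Vec (Fin n) k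
  digits ℕ.zero    l i = []
  digits (ℕ.suc k) l i =
    quotient (n ℕ.^ (k ℕ.+ l)) i ∷ digits k l (remainder {n} (n ℕ.^ (k ℕ.+ l)) i)

  rest : ∀ k l → Fin (n ℕ.^ (k ℕ.+ l)) → Fin (n ℕ.^ l)
  rest ℕ.zero    l i = i
  rest (ℕ.suc k) l i = rest k l (remainder {n} (n ℕ.^ (k ℕ.+ l)) i)

digits-^⊗ : ∀ {n m} (A : BinMatrix n m) k l i j →
  onWords A (digits k l i) (digits k l j) ∧ (A ^⊗ l) (rest k l i) (rest k l j)
    ≡ (A ^⊗ (k ℕ.+ l)) i j
digits-^⊗ A ℕ.zero    l i j = refl
digits-^⊗ {n} {m} A (ℕ.suc k) l i j =
  trans (Bool.∧-assoc Aij _ _)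
        (cong (Aij ∧_) (digits-^⊗ A k l (remainder {n} (n ℕ.^ (k ℕ.+ l)) i)
                                        (remainder {m} (m ℕ.^ (k ℕ.+ l)) j)))
  where Aij = A (quotient (n ℕ.^ (k ℕ.+ l)) i) (quotient (m ℕ.^ (k ℕ.+ l)) j)

-- One block of `k` letters is split off per step, since `suc j * k` unfolds to `k + j * k`.
wordPower-partition : ∀ {n m k} {A : BinMatrix n m} {t} → PartitionOf (onWords {k = k} A) t →
                      ∀ j → PartitionOf (A ^⊗ (j ℕ.* k)) (t ^ℚ j)
wordPower-partition P ℕ.zero    = unitFamily , (λ _ _ _ → refl) , refl
wordPower-partition {k = k} {A} P (ℕ.suc j) = PartitionOf-resp (digits-^⊗ A k (j ℕ.* k))
  (product-partition (digits k (j ℕ.* k)) (digits k (j ℕ.* k)) (rest k (j ℕ.* k)) (rest k (j ℕ.* k))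
    P (wordPower-partition P j))

-- Averaging over symmetries

module _ {I J G : Set} {A : I → J → Bool} (gs : List G) (φ : G → I → I) (ψ : G → J → J)
         (invariant : ∀ g i j → A (φ g i) (ψ g j) ≡ A i j) where

  orbit : Family A → Family A
  orbit F = record
    { indices  = cartesianProduct gs (indices F)
    ; weight   = λ (g , x) → weight F x
    ; rows     = λ (g , x) i → rows F x (φ g i)
    ; cols     = λ (g , x) j → cols F x (ψ g j)
    ; weight≥0 = λ (g , x) → weight≥0 F x
    ; allOnes  = λ (g , x) i j r c → trans (sym (invariant g i j)) (allOnes F x _ _ r c)
    }

  coverage-orbit : ∀ F i j → coverage (orbit F) i j ≡ ∑ gs λ g → coverage F (φ g i) (ψ g j)
  coverage-orbit F i j = ∑-cartesianProduct gs (indices F)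

  total-orbit : ∀ F → total (orbit F) ≡ ι (length gs) ℚ.* total F
  total-orbit F = trans (∑-cartesianProduct gs (indices F)) (∑-const gs (total F))

-- A permutation is given by insertion positions. A sum over permutations thus becomes an iterated
-- sum over insertions, which `isUniform` evaluates without listing permutations.
Perm : ℕ → Set
Perm ℕ.zero    = ⊤
Perm (ℕ.suc k) = Perm k × Fin (ℕ.suc k)

perms : ∀ k → List (Perm k)
perms ℕ.zero    = tt ∷ []
perms (ℕ.suc k) = cartesianProduct (perms k) (allFin (ℕ.suc k))

permute : ∀ {X : Set} {k} → Perm k → Vec X k → Vec X k
permute _       []       = []
permute (π , p) (x ∷ xs) = insertAt (permute π xs) p x

zipWith-permute : ∀ {X Y Z : Set} (f : X → Y → Z) {k} (π : Perm k) xs ys →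
  zipWith f (permute π xs) (permute π ys) ≡ permute π (zipWith f xs ys)
zipWith-permute f π       []       []       = refl
zipWith-permute f (π , p) (x ∷ xs) (y ∷ ys) =
  trans (zipWith-insertAt (permute π xs) (permute π ys) p)
        (cong (λ zs → insertAt zs p (f x y)) (zipWith-permute f π xs ys))
  where
  zipWith-insertAt : ∀ {k} xs ys (p : Fin (ℕ.suc k)) →
    zipWith f (insertAt xs p x) (insertAt ys p y) ≡ insertAt (zipWith f xs ys) p (f x y)
  zipWith-insertAt xs       ys       zero    = refl
  zipWith-insertAt (x ∷ xs) (y ∷ ys) (suc p) = cong (_ ∷_) (zipWith-insertAt xs ys p)

onWords-permute : ∀ {n m} (A : BinMatrix n m) {k} (π : Perm k) is js →
  onWords A (permute π is) (permute π js) ≡ onWords A is js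
onWords-permute A π       []       []       = refl
onWords-permute A (π , p) (i ∷ is) (j ∷ js) =
  trans (insert (permute π is) (permute π js) p) (cong (A i j ∧_) (onWords-permute A π is js))
  where
  insert : ∀ {k} is js (p : Fin (ℕ.suc k)) →
    onWords A (insertAt is p i) (insertAt js p j) ≡ A i j ∧ onWords A is js
  insert is         js         zero    = refl
  insert (i′ ∷ is) (j′ ∷ js) (suc p) = trans (cong (A i′ j′ ∧_) (insert is js p))
    (trans (sym (Bool.∧-assoc (A i′ j′) (A i j) _))
    (trans (cong (_∧ onWords A is js) (Bool.∧-comm (A i′ j′) (A i j)))
           (Bool.∧-assoc (A i j) (A i′ j′) _)))

flip : Fin 3 → Fin 3
flip 0F = 2F
flip 1F = 1F
flip 2F = 0F

flipIf : Bool → Fin 3 → Fin 3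
flipIf false i = i
flipIf true  i = flip i

Flips : ℕ → Set
Flips ℕ.zero    = ⊤
Flips (ℕ.suc k) = Bool × Flips k

allFlips : ∀ k → List (Flips k)
allFlips ℕ.zero    = tt ∷ []
allFlips (ℕ.suc k) = cartesianProduct (false ∷ true ∷ []) (allFlips k)

flips : ∀ {k} → Flips k → Vec (Fin 3) k → Vec (Fin 3) k
flips _       []       = []
flips (s , σ) (i ∷ is) = flipIf s i ∷ flips σ is

domino-flip : ∀ s i j → domino (flipIf s i) (flipIf s j) ≡ domino i j
domino-flip false i  j  = refl
domino-flip true  0F 0F = refl
domino-flip true  0F 1F = refl
domino-flip true  0F 2F = refl
domino-flip true  1F 0F = refl
domino-flip true  1F 1F = refl
domino-flip true  1F 2F = refl
domino-flip true  2F 0F = refl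
domino-flip true  2F 1F = refl
domino-flip true  2F 2F = refl

onWords-flips : ∀ {k} (σ : Flips k) is js →
  onWords domino (flips σ is) (flips σ js) ≡ onWords domino is js
onWords-flips σ       []       []       = refl
onWords-flips (s , σ) (i ∷ is) (j ∷ js) = cong₂ _∧_ (domino-flip s i j) (onWords-flips σ is js)

onWords-sym : ∀ {k} (is js : Vec (Fin 3) k) → onWords domino is js ≡ onWords domino js is
onWords-sym []       []       = refl
onWords-sym (i ∷ is) (j ∷ js) = cong₂ _∧_ (domino-sym i j) (onWords-sym is js)
  where
  domino-sym : ∀ i j → domino i j ≡ domino j i
  domino-sym 0F 0F = refl
  domino-sym 0F 1F = refl
  domino-sym 0F 2F = refl
  domino-sym 1F 0F = refl
  domino-sym 1F 1F = refl
  domino-sym 1F 2F = refl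
  domino-sym 2F 0F = refl
  domino-sym 2F 1F = refl
  domino-sym 2F 2F = refl

-- The orbits of the one-entries of the domino under simultaneous flips of rows and columns.
data Class : Set where
  corner colArm rowArm centre : Class

class : Fin 3 → Fin 3 → Class
class 1F 1F = centre
class 1F _  = rowArm
class _  1F = colArm
class _  _  = corner

row col row′ col′ : Class → Fin 3
row corner = 0F
row colArm = 0F
row rowArm = 1F
row centre = 1F
col corner = 0F
col colArm = 1F
col rowArm = 0F
col centre = 1F
row′ = flip ∘ row
col′ = flip ∘ col

Summand : ℕ → Set
Summand k = Vec (Fin 3) k → Vec (Fin 3) k → ℚ

_at_,_ : ∀ {k} → Summand (ℕ.suc k) → Fin 3 → Fin 3 → Summand k
(h at i , j) is js = h (i ∷ is) (j ∷ js)

-- The sum over all `2 ^ k` flips of an entry with classes `cs`, started from the representative of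
-- each class. A centre is fixed by the flip and counted twice.
flipSum : ∀ {k} → Summand k → Vec Class k → ℚ
flipSum h []       = h [] []
flipSum h (c ∷ cs) = flipSum (h at row c , col c) cs ℚ.+ flipSum (h at row′ c , col′ c) cs

flipSum-cong : ∀ {k} {g h : Summand k} cs → (∀ is js → g is js ≡ h is js) →
               flipSum g cs ≡ flipSum h cs
flipSum-cong []       eq = eq [] []
flipSum-cong (c ∷ cs) eq =
  cong₂ ℚ._+_ (flipSum-cong cs λ is js → eq _ _) (flipSum-cong cs λ is js → eq _ _)

flipSum-0 : ∀ {k} (cs : Vec Class k) → flipSum (λ _ _ → 0ℚ) cs ≡ 0ℚ
flipSum-0 []       = refl
flipSum-0 (c ∷ cs) = cong₂ ℚ._+_ (flipSum-0 cs) (flipSum-0 cs)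

flipSum-+ : ∀ {k} {g h : Summand k} cs →
            flipSum (λ is js → g is js ℚ.+ h is js) cs ≡ flipSum g cs ℚ.+ flipSum h cs
flipSum-+ []       = refl
flipSum-+ {g = g} {h} (c ∷ cs) = trans
  (cong₂ ℚ._+_ (flipSum-+ {g = g at row c , col c} {h at row c , col c} cs)
             (flipSum-+ {g = g at row′ c , col′ c} {h at row′ c , col′ c} cs))
  (solve 4 (λ a b c d → (a :+ b) :+ (c :+ d) := (a :+ c) :+ (b :+ d)) refl
    (flipSum (g at row c , col c) cs) (flipSum (h at row c , col c) cs)
    (flipSum (g at row′ c , col′ c) cs) (flipSum (h at row′ c , col′ c) cs))
  where open ℚSolver.+-*-Solver

-- A letter pair and its flip run through its class; if the pair is the flip of the representative,
-- the two summands come out swapped. The hypothesis excludes the zeros of `domino`, which `class`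
-- also sends to `corner`.
∑-flips : ∀ {k} (h : Summand k) is js → onWords domino is js ≡ true →
          ∑ (allFlips k) (λ σ → h (flips σ is) (flips σ js)) ≡ flipSum h (zipWith class is js)
∑-flips h []       []       ones = ℚ.+-identityʳ (h [] [])
∑-flips {ℕ.suc k} h (i ∷ is) (j ∷ js) ones = trans
  (∑-cartesianProduct (false ∷ true ∷ []) (allFlips k))
  (trans (cong (S i j ℚ.+_) (ℚ.+-identityʳ (S (flip i) (flip j)))) (cases i j ones))
  where
  S : Fin 3 → Fin 3 → ℚ
  S a b = ∑ (allFlips k) (λ σ → (h at a , b) (flips σ is) (flips σ js))
  Φ : Fin 3 → Fin 3 → ℚ
  Φ a b = flipSum (h at a , b) (zipWith class is js)
  part : ∀ a b → onWords domino is js ≡ true → S a b ≡ Φ a b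
  part a b = ∑-flips (h at a , b) is js
  ordered : ∀ a b c d → onWords domino is js ≡ true → S a b ℚ.+ S c d ≡ Φ a b ℚ.+ Φ c d
  ordered a b c d o = cong₂ ℚ._+_ (part a b o) (part c d o)
  swapped : ∀ a b c d → onWords domino is js ≡ true → S a b ℚ.+ S c d ≡ Φ c d ℚ.+ Φ a b
  swapped a b c d o = trans (ordered a b c d o) (ℚ.+-comm (Φ a b) (Φ c d))
  cases : ∀ i j → domino i j ∧ onWords domino is js ≡ true →
          S i j ℚ.+ S (flip i) (flip j) ≡ flipSum h (class i j ∷ zipWith class is js)
  cases 0F 0F = ordered 0F 0F 2F 2F
  cases 0F 2F ()
  cases 2F 0F ()
  cases 0F 1F = ordered 0F 1F 2F 1F
  cases 1F 0F = ordered 1F 0F 1F 2F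
  cases 1F 1F = ordered 1F 1F 1F 1F
  cases 1F 2F = swapped 1F 2F 1F 0F
  cases 2F 1F = swapped 2F 1F 0F 1F
  cases 2F 2F = swapped 2F 2F 0F 0F

-- Sets of words as tries, coverage as tables

data Trie : ℕ → Set where
  ∅    : ∀ {k} → Trie k
  end  : Trie 0
  node : ∀ {k} → Trie k → Trie k → Trie k → Trie (ℕ.suc k)

_∋_ : ∀ {k} → Trie k → Vec (Fin 3) k → Bool
∅            ∋ _        = false
-- `ε` is a pattern variable; the only trie left at this point is `end`.
ε            ∋ []       = true
(node t u v) ∋ (0F ∷ w) = t ∋ w
(node t u v) ∋ (1F ∷ w) = u ∋ w
(node t u v) ∋ (2F ∷ w) = v ∋ w

isEmpty : ∀ {k} → Trie k → Bool
isEmpty ∅ = true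
isEmpty _ = false

-- A test that the rectangle is all-ones. The zeros of `domino` are at `0F , 2F` and `2F , 0F`,
-- where one of the two subtries must be empty; the seven ones lead to recursive tests.
compatible : ∀ {k} → Trie k → Trie k → Bool
compatible ∅ _ = true
compatible _ ∅ = true
compatible end end = true
compatible (node t₀ t₁ t₂) (node u₀ u₁ u₂) =
  (isEmpty t₀ ∨ isEmpty u₂) ∧ (isEmpty t₂ ∨ isEmpty u₀) ∧
  compatible t₀ u₀ ∧ compatible t₀ u₁ ∧ compatible t₁ u₀ ∧ compatible t₁ u₁ ∧
  compatible t₁ u₂ ∧ compatible t₂ u₁ ∧ compatible t₂ u₂

compatible-sound : ∀ {k} (t u : Trie k) → compatible t u ≡ true →
  ∀ is js → t ∋ is ≡ true → u ∋ js ≡ true → onWords domino is js ≡ true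
compatible-sound end end ok [] [] ti uj = refl
compatible-sound (node t₀ t₁ t₂) (node u₀ u₁ u₂) ok (i ∷ is) (j ∷ js) ti uj
  with ok₀₂ , ok ← ∧-true⁻ {isEmpty t₀ ∨ isEmpty u₂} ok
  with ok₂₀ , ok ← ∧-true⁻ {isEmpty t₂ ∨ isEmpty u₀} ok
  with ok₀₀ , ok ← ∧-true⁻ {compatible t₀ u₀} ok
  with ok₀₁ , ok ← ∧-true⁻ {compatible t₀ u₁} ok
  with ok₁₀ , ok ← ∧-true⁻ {compatible t₁ u₀} ok
  with ok₁₁ , ok ← ∧-true⁻ {compatible t₁ u₁} ok
  with ok₁₂ , ok ← ∧-true⁻ {compatible t₁ u₂} ok
  with ok₂₁ , ok₂₂ ← ∧-true⁻ {compatible t₂ u₁} ok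
  = cases i j ti uj
  where
  clash : ∀ {k} (t u : Trie k) {X : Set} is js → isEmpty t ∨ isEmpty u ≡ true →
          t ∋ is ≡ true → u ∋ js ≡ true → X
  clash end            ∅            is js _  _  ()
  clash (node _ _ _) ∅            is js _  _  ()
  cases : ∀ i j → node t₀ t₁ t₂ ∋ (i ∷ is) ≡ true → node u₀ u₁ u₂ ∋ (j ∷ js) ≡ true →
          domino i j ∧ onWords domino is js ≡ true
  cases 0F 0F = compatible-sound t₀ u₀ ok₀₀ is js
  cases 0F 1F = compatible-sound t₀ u₁ ok₀₁ is js
  cases 0F 2F = clash t₀ u₂ is js ok₀₂
  cases 1F 0F = compatible-sound t₁ u₀ ok₁₀ is js
  cases 1F 1F = compatible-sound t₁ u₁ ok₁₁ is js
  cases 1F 2F = compatible-sound t₁ u₂ ok₁₂ is js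
  cases 2F 0F = clash t₂ u₀ is js ok₂₀
  cases 2F 1F = compatible-sound t₂ u₁ ok₂₁ is js
  cases 2F 2F = compatible-sound t₂ u₂ ok₂₂ is js

-- A function on class words; `𝟘` is the zero function at any depth, which keeps the tables of small
-- rectangles sparse.
data Table : ℕ → Set where
  𝟘    : ∀ {k} → Table k
  leaf : ℕ → Table 0
  node : ∀ {k} (a b c d : Table k) → Table (ℕ.suc k)

value : ∀ {k} → Table k → Vec Class k → ℚ
value 𝟘              _             = 0ℚ
value (leaf n)       []            = ι n
value (node a b c d) (corner ∷ cs) = value a cs
value (node a b c d) (colArm ∷ cs) = value b cs
value (node a b c d) (rowArm ∷ cs) = value c cs
value (node a b c d) (centre ∷ cs) = value d cs

infixr 6 _⊕_

_⊕_ : ∀ {k} → Table k → Table k → Table k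
𝟘 ⊕ t = t
t ⊕ 𝟘 = t
leaf m ⊕ leaf n = leaf (m ℕ.+ n)
node a b c d ⊕ node a′ b′ c′ d′ = node (a ⊕ a′) (b ⊕ b′) (c ⊕ c′) (d ⊕ d′)

value-⊕ : ∀ {k} (t u : Table k) cs → value (t ⊕ u) cs ≡ value t cs ℚ.+ value u cs
value-⊕ 𝟘              u  cs = sym (ℚ.+-identityˡ (value u cs))
value-⊕ t@(leaf _)       𝟘 cs = sym (ℚ.+-identityʳ (value t cs))
value-⊕ t@(node _ _ _ _) 𝟘 cs = sym (ℚ.+-identityʳ (value t cs))
value-⊕ (leaf m) (leaf n) []  = ι-+ m n
value-⊕ (node a b c d) (node a′ b′ c′ d′) (corner ∷ cs) = value-⊕ a a′ cs
value-⊕ (node a b c d) (node a′ b′ c′ d′) (colArm ∷ cs) = value-⊕ b b′ cs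
value-⊕ (node a b c d) (node a′ b′ c′ d′) (rowArm ∷ cs) = value-⊕ c c′ cs
value-⊕ (node a b c d) (node a′ b′ c′ d′) (centre ∷ cs) = value-⊕ d d′ cs

coverTable : ∀ {k} → ℕ → Trie k → Trie k → Table k
coverTable w ∅ _ = 𝟘
coverTable w _ ∅ = 𝟘
coverTable w end end = leaf w
coverTable w (node t₀ t₁ t₂) (node u₀ u₁ u₂) = node
  (coverTable w t₀ u₀ ⊕ coverTable w t₂ u₂)
  (coverTable w t₀ u₁ ⊕ coverTable w t₂ u₁)
  (coverTable w t₁ u₀ ⊕ coverTable w t₁ u₂)
  -- Both flips of a centre land on the same pair of subtries.
  (coverTable w t₁ u₁ ⊕ coverTable w t₁ u₁)

value-coverTable : ∀ {k} w (t u : Trie k) cs →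
  value (coverTable w t u) cs ≡ flipSum (λ is js → ι w ℚ.* 𝟙[ t ∋ is ∧ u ∋ js ]) cs
value-coverTable w ∅ u cs =
  sym (trans (flipSum-cong cs λ _ _ → ℚ.*-zeroʳ (ι w)) (flipSum-0 cs))
value-coverTable w t@end ∅ cs = sym (trans
  (flipSum-cong cs λ is _ → trans (cong (λ b → ι w ℚ.* 𝟙[ b ]) (Bool.∧-zeroʳ (t ∋ is))) (ℚ.*-zeroʳ (ι w)))
  (flipSum-0 cs))
value-coverTable w t@(node _ _ _) ∅ cs = sym (trans
  (flipSum-cong cs λ is _ → trans (cong (λ b → ι w ℚ.* 𝟙[ b ]) (Bool.∧-zeroʳ (t ∋ is))) (ℚ.*-zeroʳ (ι w)))
  (flipSum-0 cs))
value-coverTable w end end [] = sym (ℚ.*-identityʳ (ι w))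
value-coverTable w (node t₀ t₁ t₂) (node u₀ u₁ u₂) (c ∷ cs) with c
... | corner = trans (value-⊕ (coverTable w t₀ u₀) (coverTable w t₂ u₂) cs)
                     (cong₂ ℚ._+_ (value-coverTable w t₀ u₀ cs) (value-coverTable w t₂ u₂ cs))
... | colArm = trans (value-⊕ (coverTable w t₀ u₁) (coverTable w t₂ u₁) cs)
                     (cong₂ ℚ._+_ (value-coverTable w t₀ u₁ cs) (value-coverTable w t₂ u₁ cs))
... | rowArm = trans (value-⊕ (coverTable w t₁ u₀) (coverTable w t₁ u₂) cs)
                     (cong₂ ℚ._+_ (value-coverTable w t₁ u₀ cs) (value-coverTable w t₁ u₂ cs))
... | centre = trans (value-⊕ (coverTable w t₁ u₁) (coverTable w t₁ u₁) cs)
                     (cong₂ ℚ._+_ (value-coverTable w t₁ u₁ cs) (value-coverTable w t₁ u₁ cs))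

child : ∀ {k} → Class → Table (ℕ.suc k) → Table k
child c      𝟘              = 𝟘
child corner (node a b c d) = a
child colArm (node a b c d) = b
child rowArm (node a b c d) = c
child centre (node a b c d) = d

value-child : ∀ {k} c (t : Table (ℕ.suc k)) cs → value (child c t) cs ≡ value t (c ∷ cs)
value-child c      𝟘              cs = refl
value-child corner (node a b c d) cs = refl
value-child colArm (node a b c d) cs = refl
value-child rowArm (node a b c d) cs = refl
value-child centre (node a b c d) cs = refl

-- The new letter `c` either comes first, which leaves `child c t`, or stands behind the first
-- letter, and then the recursion runs below each possible class of that letter.
insertions : ∀ {k} → Class → Table (ℕ.suc k) → Table k
insertions {ℕ.zero}  c t = child c t
insertions {ℕ.suc k} c t = child c t ⊕ node
  (insertions c (child corner t)) (insertions c (child colArm t))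
  (insertions c (child rowArm t)) (insertions c (child centre t))

value-insertions : ∀ {k} c (t : Table (ℕ.suc k)) cs →
  value (insertions c t) cs ≡ ∑ (allFin (ℕ.suc k)) λ p → value t (insertAt cs p c)
value-insertions {ℕ.zero}  c t [] =
  trans (value-child c t []) (sym (ℚ.+-identityʳ (value t (c ∷ []))))
value-insertions {ℕ.suc k} c t (d ∷ ds) = begin
  value (child c t ⊕ others) (d ∷ ds)
    ≡⟨ value-⊕ (child c t) others (d ∷ ds) ⟩
  value (child c t) (d ∷ ds) ℚ.+ value others (d ∷ ds)
    ≡⟨ cong₂ ℚ._+_ (value-child c t (d ∷ ds)) (others-child d) ⟩
  value t (c ∷ d ∷ ds) ℚ.+ value (insertions c (child d t)) ds
    ≡⟨ cong (value t (c ∷ d ∷ ds) ℚ.+_) (trans (value-insertions c (child d t) ds)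
         (∑-cong (allFin (ℕ.suc k)) λ p → value-child d t (insertAt ds p c))) ⟩
  value t (c ∷ d ∷ ds) ℚ.+ ∑ (allFin (ℕ.suc k)) (λ p → value t (insertAt (d ∷ ds) (suc p) c))
    ≡⟨ ∑-allFin (ℕ.suc k) (λ p → value t (insertAt (d ∷ ds) p c)) ⟨
  ∑ (allFin (ℕ.suc (ℕ.suc k))) (λ p → value t (insertAt (d ∷ ds) p c))
    ∎
  where
  open ≡-Reasoning
  others = node
    (insertions c (child corner t)) (insertions c (child colArm t))
    (insertions c (child rowArm t)) (insertions c (child centre t))
  others-child : ∀ d → value others (d ∷ ds) ≡ value (insertions c (child d t)) ds
  others-child corner = refl
  others-child colArm = refl
  others-child rowArm = refl
  others-child centre = refl

-- After `k` rounds of `insertions` a single number is left for each of the `4 ^ k` class words: the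
-- sum of the table over all permutations of that word.
isUniform : ∀ {k} → Table k → ℕ → Bool
isUniform {ℕ.zero}  𝟘        n = n ℕ.≡ᵇ 0
isUniform {ℕ.zero}  (leaf m) n = m ℕ.≡ᵇ n
isUniform {ℕ.suc k} t        n =
  isUniform (insertions corner t) n ∧ isUniform (insertions colArm t) n ∧
  isUniform (insertions rowArm t) n ∧ isUniform (insertions centre t) n

isUniform-sound : ∀ {k} (t : Table k) n → isUniform t n ≡ true → ∀ cs →
  ∑ (perms k) (λ π → value t (permute π cs)) ≡ ι n
isUniform-sound {ℕ.zero} 𝟘 ℕ.zero ok [] = refl
isUniform-sound {ℕ.zero} (leaf m) n ok [] = trans (ℚ.+-identityʳ (ι m))
  (cong ι (ℕ.≡ᵇ⇒≡ m n (subst Bool.T (sym ok) tt)))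
isUniform-sound {ℕ.suc k} t n ok (c ∷ cs) = begin
  ∑ (perms (ℕ.suc k)) (λ π → value t (permute π (c ∷ cs)))
    ≡⟨ ∑-cartesianProduct (perms k) (allFin (ℕ.suc k)) ⟩
  ∑ (perms k) (λ π → ∑ (allFin (ℕ.suc k)) λ p → value t (insertAt (permute π cs) p c))
    ≡⟨ ∑-cong (perms k) (λ π → value-insertions c t (permute π cs)) ⟨
  ∑ (perms k) (λ π → value (insertions c t) (permute π cs))
    ≡⟨ isUniform-sound (insertions c t) n (child-ok c) cs ⟩
  ι n
    ∎
  where
  open ≡-Reasoning
  child-ok : ∀ c → isUniform (insertions c t) n ≡ true
  child-ok corner = proj₁ (∧-true⁻ ok)
  child-ok colArm = proj₁ (∧-true⁻ (proj₂ (∧-true⁻ {isUniform (insertions corner t) n} ok)))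
  child-ok rowArm = proj₁ (∧-true⁻ (proj₂ (∧-true⁻ {isUniform (insertions colArm t) n}
    (proj₂ (∧-true⁻ {isUniform (insertions corner t) n} ok)))))
  child-ok centre = proj₂ (∧-true⁻ {isUniform (insertions rowArm t) n}
    (proj₂ (∧-true⁻ {isUniform (insertions colArm t) n}
    (proj₂ (∧-true⁻ {isUniform (insertions corner t) n} ok)))))

record Block (k : ℕ) : Set where
  constructor block
  field
    mass        : ℕ
    rowTrie     : Trie k
    colTrie     : Trie k
    isOnes      : compatible rowTrie colTrie ≡ true

open Block

module _ {k : ℕ} where

  -- Each block enters together with its transpose, which is again all-ones because `domino` is
  -- symmetric; only one of the two has to be listed.
  blockFamily : List (Block k) → Family (onWords {k = k} domino)
  blockFamily bs = record
    { indices  = cartesianProduct bs (false ∷ true ∷ [])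
    ; weight   = λ (b , _) → ι (mass b)
    ; rows     = λ (b , transposed) → (if transposed then colTrie b else rowTrie b) ∋_
    ; cols     = λ (b , transposed) → (if transposed then rowTrie b else colTrie b) ∋_
    ; weight≥0 = λ (b , _) → ι≥0 (mass b)
    ; allOnes  = ones
    }
    where
    ones : ∀ ((b , transposed) : Block k × Bool) is js →
           (if transposed then colTrie b else rowTrie b) ∋ is ≡ true →
           (if transposed then rowTrie b else colTrie b) ∋ js ≡ true → onWords domino is js ≡ true
    ones (b , false) is js r c = compatible-sound (rowTrie b) (colTrie b) (isOnes b) is js r c
    ones (b , true)  is js r c = trans (onWords-sym is js)
      (compatible-sound (rowTrie b) (colTrie b) (isOnes b) js is c r)

  blockTable : List (Block k) → Table k
  blockTable []       = 𝟘
  blockTable (b ∷ bs) = coverTable (mass b) (rowTrie b) (colTrie b)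
                      ⊕ coverTable (mass b) (colTrie b) (rowTrie b) ⊕ blockTable bs

  value-blockTable : ∀ bs cs → value (blockTable bs) cs ≡ flipSum (coverage (blockFamily bs)) cs
  value-blockTable []       cs = sym (flipSum-0 cs)
  value-blockTable (b ∷ bs) cs = begin
    value (t ⊕ u ⊕ blockTable bs) cs
      ≡⟨ trans (value-⊕ t (u ⊕ blockTable bs) cs) (cong (value t cs ℚ.+_) (value-⊕ u (blockTable bs) cs)) ⟩
    value t cs ℚ.+ (value u cs ℚ.+ value (blockTable bs) cs)
      ≡⟨ cong₂ ℚ._+_ (value-coverTable (mass b) (rowTrie b) (colTrie b) cs)
           (cong₂ ℚ._+_ (value-coverTable (mass b) (colTrie b) (rowTrie b) cs) (value-blockTable bs cs)) ⟩
    flipSum f cs ℚ.+ (flipSum g cs ℚ.+ flipSum h cs)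
      ≡⟨ trans (flipSum-+ {g = f} cs) (cong (flipSum f cs ℚ.+_) (flipSum-+ {g = g} {h} cs)) ⟨
    flipSum (λ is js → f is js ℚ.+ (g is js ℚ.+ h is js)) cs
      ∎
    where
    open ≡-Reasoning
    t = coverTable (mass b) (rowTrie b) (colTrie b)
    u = coverTable (mass b) (colTrie b) (rowTrie b)
    f g h : Summand k
    f is js = ι (mass b) ℚ.* 𝟙[ rowTrie b ∋ is ∧ colTrie b ∋ js ]
    g is js = ι (mass b) ℚ.* 𝟙[ colTrie b ∋ is ∧ rowTrie b ∋ js ]
    h = coverage (blockFamily bs)

  blockMass : List (Block k) → ℕ
  blockMass []       = 0
  blockMass (b ∷ bs) = mass b ℕ.+ (mass b ℕ.+ blockMass bs)

  total-blockFamily : ∀ bs → total (blockFamily bs) ≡ ι (blockMass bs)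
  total-blockFamily []       = refl
  total-blockFamily (b ∷ bs) = sym (trans (ι-+ (mass b) _)
    (cong (ι (mass b) ℚ.+_) (trans (ι-+ (mass b) _)
    (cong (ι (mass b) ℚ.+_) (sym (total-blockFamily bs))))))

  -- Averaging over all flips, permutations of the factors and transposition makes the
  -- coverage depend only on the classes of the factors up to order.
  symmetrised-partition : ∀ bs n .{{_ : ℕ.NonZero n}} → isUniform (blockTable bs) n ≡ true →
    PartitionOf (onWords {k = k} domino)
      ((ℤ.+ 1 ℚ./ n) ℚ.* ι (length (perms k) ℕ.* (length (allFlips k) ℕ.* blockMass bs)))
  symmetrised-partition bs n ok = scale c c≥0 F₂ , partition , total-F
    where
    c = ℤ.+ 1 ℚ./ n
    c≥0 : 0ℚ ℚ.≤ c
    c≥0 = ℚ.nonNegative⁻¹ c {{ℚ.normalize-nonNeg 1 n}}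
    F₀ = blockFamily bs
    F₁ = orbit (allFlips k) flips flips onWords-flips F₀
    F₂ = orbit (perms k) permute permute (onWords-permute domino) F₁
    open ≡-Reasoning
    coverage-F₁ : ∀ is js → onWords domino is js ≡ true →
                  coverage F₁ is js ≡ value (blockTable bs) (zipWith class is js)
    coverage-F₁ is js ones = begin
      coverage F₁ is js
        ≡⟨ coverage-orbit (allFlips k) flips flips onWords-flips F₀ is js ⟩
      ∑ (allFlips k) (λ σ → coverage F₀ (flips σ is) (flips σ js))
        ≡⟨ ∑-flips (coverage F₀) is js ones ⟩
      flipSum (coverage F₀) (zipWith class is js)
        ≡⟨ value-blockTable bs (zipWith class is js) ⟨
      value (blockTable bs) (zipWith class is js)
        ∎
    partition : ∀ is js → onWords domino is js ≡ true → coverage (scale c c≥0 F₂) is js ≡ 1ℚ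
    partition is js ones = begin
      coverage (scale c c≥0 F₂) is js
        ≡⟨ coverage-scale c c≥0 F₂ is js ⟩
      c ℚ.* coverage F₂ is js
        ≡⟨ cong (c ℚ.*_) (coverage-orbit (perms k) permute permute (onWords-permute domino) F₁ is js) ⟩
      c ℚ.* ∑ (perms k) (λ π → coverage F₁ (permute π is) (permute π js))
        ≡⟨ cong (c ℚ.*_) (∑-cong (perms k) λ π → trans
             (coverage-F₁ _ _ (trans (onWords-permute domino π is js) ones))
             (cong (value (blockTable bs)) (zipWith-permute class π is js))) ⟩
      c ℚ.* ∑ (perms k) (λ π → value (blockTable bs) (permute π (zipWith class is js)))
        ≡⟨ cong (c ℚ.*_) (isUniform-sound (blockTable bs) n ok (zipWith class is js)) ⟩
      c ℚ.* ι n
        ≡⟨ trans (ℚ.*-comm c (ι n)) (ι-/ 1 n) ⟩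
      1ℚ
        ∎
    p = length (perms k)
    f = length (allFlips k)
    total-F : total (scale c c≥0 F₂) ≡ c ℚ.* ι (p ℕ.* (f ℕ.* blockMass bs))
    total-F = begin
      total (scale c c≥0 F₂)
        ≡⟨ total-scale c c≥0 F₂ ⟩
      c ℚ.* total F₂
        ≡⟨ cong (c ℚ.*_) (total-orbit (perms k) permute permute (onWords-permute domino) F₁) ⟩
      c ℚ.* (ι p ℚ.* total F₁)
        ≡⟨ cong (λ t → c ℚ.* (ι p ℚ.* t)) (total-orbit (allFlips k) flips flips onWords-flips F₀) ⟩
      c ℚ.* (ι p ℚ.* (ι f ℚ.* total F₀))
        ≡⟨ cong (λ t → c ℚ.* (ι p ℚ.* (ι f ℚ.* t))) (total-blockFamily bs) ⟩
      c ℚ.* (ι p ℚ.* (ι f ℚ.* ι (blockMass bs)))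
        ≡⟨ cong (λ t → c ℚ.* (ι p ℚ.* t)) (ι-* f (blockMass bs)) ⟨
      c ℚ.* (ι p ℚ.* ι (f ℕ.* blockMass bs))
        ≡⟨ cong (c ℚ.*_) (ι-* p (f ℕ.* blockMass bs)) ⟨
      c ℚ.* ι (p ℕ.* (f ℕ.* blockMass bs))
        ∎

ι-^ : ∀ m k → ι (m ℕ.^ k) ≡ ι m ^ℚ k
ι-^ m ℕ.zero    = refl
ι-^ m (ℕ.suc k) = trans (ι-* m (m ℕ.^ k)) (cong (ι m ℚ.*_) (ι-^ m k))

-- Multiplying by `n` and `d ^ k` clears all denominators and leaves a comparison of natural
-- numbers, which evaluation decides.
ratio≤^ : ∀ x m d n a k .{{_ : ℕ.NonZero d}} .{{_ : ℕ.NonZero n}} → ι d ℚ.* x ≡ ι m →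
          a ℕ.* d ℕ.^ k ℕ.≤ n ℕ.* m ℕ.^ k → (ℤ.+ 1 ℚ./ n) ℚ.* ι a ℚ.≤ x ^ℚ k
ratio≤^ x m d n a k dx≡m ad≤nm = ℚ.*-cancelˡ-≤-pos (ι N)
  (subst₂ ℚ._≤_ (sym left) (sym right) (ι-mono ad≤nm))
  where
  N = n ℕ.* d ℕ.^ k
  instance
    d^k≢0 = ℕ.m^n≢0 d k
    N≢0 = ℕ.m*n≢0 n (d ℕ.^ k)
    ιN⁺ = ℚ.normalize-pos N 1
  r = ℤ.+ 1 ℚ./ n
  open ≡-Reasoning
  left : ι N ℚ.* (r ℚ.* ι a) ≡ ι (a ℕ.* d ℕ.^ k)
  left = begin
    ι N ℚ.* (r ℚ.* ι a)                     ≡⟨ cong (ℚ._* (r ℚ.* ι a)) (ι-* n (d ℕ.^ k)) ⟩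
    ι n ℚ.* ι (d ℕ.^ k) ℚ.* (r ℚ.* ι a)       ≡⟨ solve 4 (λ n e r a → n :* e :* (r :* a) := n :* r :* (a :* e))
                                             refl (ι n) (ι (d ℕ.^ k)) r (ι a) ⟩
    ι n ℚ.* r ℚ.* (ι a ℚ.* ι (d ℕ.^ k))       ≡⟨ cong (ℚ._* (ι a ℚ.* ι (d ℕ.^ k))) (ι-/ 1 n) ⟩
    1ℚ ℚ.* (ι a ℚ.* ι (d ℕ.^ k))            ≡⟨ ℚ.*-identityˡ (ι a ℚ.* ι (d ℕ.^ k)) ⟩
    ι a ℚ.* ι (d ℕ.^ k)                   ≡⟨ ι-* a (d ℕ.^ k) ⟨
    ι (a ℕ.* d ℕ.^ k)                   ∎
    where open ℚSolver.+-*-Solver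
  right : ι N ℚ.* x ^ℚ k ≡ ι (n ℕ.* m ℕ.^ k)
  right = begin
    ι N ℚ.* x ^ℚ k                         ≡⟨ cong (ℚ._* x ^ℚ k) (ι-* n (d ℕ.^ k)) ⟩
    ι n ℚ.* ι (d ℕ.^ k) ℚ.* x ^ℚ k           ≡⟨ ℚ.*-assoc (ι n) (ι (d ℕ.^ k)) (x ^ℚ k) ⟩
    ι n ℚ.* (ι (d ℕ.^ k) ℚ.* x ^ℚ k)         ≡⟨ cong (λ e → ι n ℚ.* (e ℚ.* x ^ℚ k)) (ι-^ d k) ⟩
    ι n ℚ.* (ι d ^ℚ k ℚ.* x ^ℚ k)             ≡⟨ cong (ι n ℚ.*_) (Exp.^-distrib-* (ι d) x k) ⟨
    ι n ℚ.* (ι d ℚ.* x) ^ℚ k                 ≡⟨ cong (λ y → ι n ℚ.* y ^ℚ k) dx≡m ⟩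
    ι n ℚ.* ι m ^ℚ k                       ≡⟨ cong (ι n ℚ.*_) (ι-^ m k) ⟨
    ι n ℚ.* ι (m ℕ.^ k)                   ≡⟨ ι-* n (m ℕ.^ k) ⟨
    ι (n ℕ.* m ℕ.^ k)                   ∎

-- Bit Σ dᵢ 3^(k-1-i) of the mask tells whether the word d₀ … d₍ₖ₋₁₎ belongs to the set.
fromMask : ∀ k → ℕ → Trie k
fromMask ℕ.zero    0 = ∅
fromMask ℕ.zero    _ = end
fromMask (ℕ.suc k) 0 = ∅
fromMask (ℕ.suc k) m = node (fromMask k (m ℕ.% B)) (fromMask k (m ℕ./ B ℕ.% B)) (fromMask k (m ℕ./ B ℕ./ B))
  where
  B = 2 ℕ.^ (3 ℕ.^ k)
  instance B≢0 = ℕ.m^n≢0 2 (3 ℕ.^ k)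

-- A near-optimal solution of the linear program for the fifth power, reduced by the symmetry group
-- and multiplied by the common denominator 81676504073707584.
dominoBlocks : List (Block 5)
dominoBlocks =
    block 569610587673698136
      (fromMask 5 0x2402000482400000000002010002402)
      (fromMask 5 0x28000a0500000000002816800502d) refl
  ∷ block 459826685481351064
      (fromMask 5 0x2000082400000000002090002412)
      (fromMask 5 0x5000145a00000000005168005a2d) refl
  ∷ block 426912344674648608
      (fromMask 5 0x160100004020000000001b018001201)
      (fromMask 5 0x201000040360000000001009000301b) refl
  ∷ block 412264399865224092
      (fromMask 5 0x2000002400000000002010002412)
      (fromMask 5 0x5a2d000a05a0000000002d028005a2d) refl
  ∷ block 402009048965994456
      (fromMask 5 0x2402000480400000000012010002412)
      (fromMask 5 0x5000005a0000000000016800502d) refl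
  ∷ block 328475233791384720
      (fromMask 5 0x90000032000000000080c800301b)
      (fromMask 5 0x2010000c020000000000b008003603) refl
  ∷ block 308774307884834256
      (fromMask 5 0x100000060000000000104800161b)
      (fromMask 5 0x100000060000000000104800161b) refl
  ∷ block 307384807192478016
      (fromMask 5 0x200008240000000000201800241b)
      (fromMask 5 0x16010006c1600000000001008001609) refl
  ∷ block 303106796470531960
      (fromMask 5 0x2412000482400000000012090002412)
      (fromMask 5 0xa00000000000028000a2d) refl
  ∷ block 242295989332233312
      (fromMask 5 0x100000024000000000180c000361b)
      (fromMask 5 0x161b000040600000000009048000201) refl
  ∷ block 237585872540543688
      (fromMask 5 0x412000482400000000000090000012)
      (fromMask 5 0xa00000b4000000000002d028005a2d) refl
  ∷ block 207222744308516784
      (fromMask 5 0x2412000482400000000012010002402)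
      (fromMask 5 0x2800000500000000002816800502d) refl
  ∷ block 185738322542597928
      (fromMask 5 0x412000482400000000000090000012)
      (fromMask 5 0xa00000b4000000000002d168005a2d) refl
  ∷ block 174393270801444240
      (fromMask 5 0x402000480400000000012010002412)
      (fromMask 5 0x5000005a0000000000016800502d) refl
  ∷ block 168108878063011816
      (fromMask 5 0x412000482400000000012090002412)
      (fromMask 5 0x5000145a00000000005168005a2d) refl
  ∷ block 164011968891992736
      (fromMask 5 0x16000006c000000000000b05800361b)
      (fromMask 5 0x2010002c160000000000000800000b) refl
  ∷ block 154674905731971904
      (fromMask 5 0x20000000000000800000b)
      (fromMask 5 0x16010006c160000000001b05800361b) refl
  ∷ block 150589301369319696
      (fromMask 5 0x16000006c000000000001b05800361b)
      (fromMask 5 0x2010002c160000000000000800000b) refl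
  ∷ block 147556706730193920
      (fromMask 5 0x16000006c3600000000009000001209)
      (fromMask 5 0x41200000240000000001b0d800001b) refl
  ∷ block 122153003628490992
      (fromMask 5 0x2010000402000000000010080002010)
      (fromMask 5 0x28b45005168a00000000145a28028b55) refl
  ∷ block 113504952648955440
      (fromMask 5 0x900000120000000000201800160b)
      (fromMask 5 0x900000120000000000201800160b) refl
  ∷ block 110625176041510320
      (fromMask 5 0x240000000000201000061b)
      (fromMask 5 0x161b000043600000000003058000209) refl
  ∷ block 81676504073707584
      (fromMask 5 0x2000000400000000000010000002000)
      (fromMask 5 0x5142145a28028a00000028a00a2d142145) refl
  ∷ block 71232115324614240
      (fromMask 5 0x16000006c3600000000009000001209)
      (fromMask 5 0x1200000240000000001b0d800001b) refl
  ∷ block 55891561175325480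
      (fromMask 5 0x412000482400000000000010000412)
      (fromMask 5 0x500014500000000002d168005a2d) refl
  ∷ block 49728193697030016
      (fromMask 5 0x16000006c3600000000009000001201)
      (fromMask 5 0x201200000240000000001b0d800001b) refl
  ∷ block 49654295098569840
      (fromMask 5 0x2000000400000000000010000002000)
      (fromMask 5 0x5140145a28028a00000028a00a2d142145) refl
  ∷ block 37694441403003104
      (fromMask 5 0x105800161b)
      (fromMask 5 0x20b0002c360000000000000800020b) refl
  ∷ block 33115460890365552
      (fromMask 5 0x402000082400000000002090002412)
      (fromMask 5 0xa05000145a00000000005168005a2d) refl
  ∷ block 30183811460753820
      (fromMask 5 0x2000082400000000002090002412)
      (fromMask 5 0x5005000145a00000000005168005a2d) refl
  ∷ block 28002722708944344
      (fromMask 5 0x2412000482400000000000080002412)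
      (fromMask 5 0xa05000000000000000005168000a05) refl
  ∷ block 4018134028942039
      (fromMask 5 0x2000000000000000000010000000000)
      (fromMask 5 0x28a00a28000000a28028b45005140000005140145) refl
  ∷ block 3969240127828344
      (fromMask 5 0x2000000000000000000000000000000)
      (fromMask 5 0x5140145000400145005140010000415410000400145005140010005140145) refl
  ∷ block 187685644472400
      (fromMask 5 0x16010006c1600000000001000001601)
      (fromMask 5 0x201a00000200000000001a0d800201b) refl
  ∷ []

domino-partition : ∃ λ t → PartitionOf (onWords {k = 5} domino) t
                         × t ℚ.≤ (ℤ.+ 2372713 ℚ./ 1000000) ^ℚ 5
domino-partition = _ ,
  -- `refl` runs the uniformity check. Group order and transposes cancel in the total, which is the
  -- sum of the 34 masses over their common denominator.
  symmetrised-partition dominoBlocks coverageConstant refl ,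
  ratio≤^ (ℤ.+ 2372713 ℚ./ 1000000) 2372713 1000000 coverageConstant
    (length (perms 5) ℕ.* (length (allFlips 5) ℕ.* blockMass dominoBlocks)) 5
    (ι-/ 2372713 1000000)
    (ℕ.≤ᵇ⇒≤ _ _ tt)
  where
  -- 2 · 5! · 2⁵ times the common denominator.
  coverageConstant = 7680 ℕ.* 81676504073707584

-- Real numbers as limits

module _ {P Q : ℕ → Set} where

  eventually-map : (∀ n → P n → Q n) → Eventually P → Eventually Q
  eventually-map f evP k = evP λ (N , p) → k (N , λ n N≤n → f n (p n N≤n))

  eventually-× : Eventually P → Eventually Q → Eventually λ n → P n × Q n
  eventually-× evP evQ k = evP λ (N , p) → evQ λ (M , q) →
    k (N ℕ.⊔ M , λ n ≤n → p n (ℕ.m⊔n≤o⇒m≤o N M ≤n) , q n (ℕ.m⊔n≤o⇒n≤o N M ≤n))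

eventually-∀ : ∀ {m} {P : Fin m → ℕ → Set} → (∀ i → Eventually (P i)) →
               Eventually λ n → ∀ i → P i n
eventually-∀ {ℕ.zero}  ev k = k (0 , λ _ _ ())
eventually-∀ {ℕ.suc m} ev = eventually-map
  (λ { n (p , ps) zero → p ; n (p , ps) (suc i) → ps i })
  (eventually-× (ev zero) (eventually-∀ (ev ∘ suc)))

eventually-→ : ∀ {b : Bool} {P : ℕ → Set} → (b ≡ true → Eventually P) →
               Eventually λ n → b ≡ true → P n
eventually-→ {true}  ev = eventually-map (λ _ p _ → p) (ev refl)
eventually-→ {false} ev k = k (0 , λ _ _ ())

½-pos : ∀ {ε} → 0ℚ ℚ.< ε → 0ℚ ℚ.< ε ℚ.* ½
½-pos {ε} ε>0 = subst (ℚ._< ε ℚ.* ½) (ℚ.*-zeroˡ ½) (ℚ.*-monoˡ-<-pos ½ ε>0)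

½+½ : ∀ ε → ε ℚ.* ½ ℚ.+ ε ℚ.* ½ ≡ ε
½+½ ε = trans (sym (ℚ.*-distribˡ-+ ε ½ ½)) (ℚ.*-identityʳ ε)

half< : ∀ {p} → 0ℚ ℚ.< p → p ℚ.* ½ ℚ.< p
half< {p} p>0 = subst₂ ℚ._<_ (ℚ.+-identityʳ (p ℚ.* ½)) (½+½ p)
  (ℚ.+-monoʳ-< (p ℚ.* ½) (½-pos p>0))

≤-halves : ∀ p q r ε → p ℚ.≤ q ℚ.+ ε ℚ.* ½ → q ℚ.≤ r ℚ.+ ε ℚ.* ½ → p ℚ.≤ r ℚ.+ ε
≤-halves p q r ε p≤q q≤r = ℚ.≤-trans p≤q
  (ℚ.≤-trans (ℚ.+-monoˡ-≤ (ε ℚ.* ½) q≤r)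
    (ℚ.≤-reflexive (trans (ℚ.+-assoc r (ε ℚ.* ½) (ε ℚ.* ½)) (cong (r ℚ.+_) (½+½ ε)))))

p≤p+ε : ∀ p {ε} → 0ℚ ℚ.≤ ε → p ℚ.≤ p ℚ.+ ε
p≤p+ε p {ε} ε≥0 = subst (ℚ._≤ p ℚ.+ ε) (ℚ.+-identityʳ p) (ℚ.+-monoʳ-≤ p ε≥0)

p≤∣p∣ : ∀ p → p ℚ.≤ ∣ p ∣
p≤∣p∣ p with ℚ.≤-total 0ℚ p
... | inj₁ p≥0 = ℚ.≤-reflexive (sym (ℚ.0≤p⇒∣p∣≡p p≥0))
... | inj₂ p≤0 = ℚ.≤-trans p≤0 (ℚ.0≤∣p∣ p)

≤-trans : ∀ x y z → x ≤ y → y ≤ z → x ≤ z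
≤-trans x y z x≤y y≤z ε ε>0 = eventually-map (λ n (p , q) → ≤-halves (seq x n) (seq y n) (seq z n) ε p q)
  (eventually-× (x≤y (ε ℚ.* ½) (½-pos ε>0)) (y≤z (ε ℚ.* ½) (½-pos ε>0)))

pointwise-≤ : ∀ x y → (∀ n → seq x n ℚ.≤ seq y n) → x ≤ y
pointwise-≤ x y x≤y ε ε>0 k =
  k (0 , λ n _ → ℚ.≤-trans (x≤y n) (p≤p+ε (seq y n) (ℚ.<⇒≤ ε>0)))

pointwise-≃ : ∀ x y → (∀ n → seq x n ≡ seq y n) → x ≃ y
pointwise-≃ x y x≡y =
  pointwise-≤ x y (ℚ.≤-reflexive ∘ x≡y) , pointwise-≤ y x (ℚ.≤-reflexive ∘ sym ∘ x≡y)

-- If `q < p`, a rational `r` strictly between them gives the tolerance `r - q`, too small to reach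
-- `p`.
fromℚ-cancel-≤ : ∀ p q → fromℚ p ≤ fromℚ q → p ℚ.≤ q
fromℚ-cancel-≤ p q p≤q = ℚ.≮⇒≥ λ q<p →
  let r , q<r , r<p = ℚ.<-dense q<p
      r-q>0 = subst (ℚ._< r ℚ.- q) (ℚ.+-inverseʳ q) (ℚ.+-monoˡ-< (ℚ.- q) q<r)
  in p≤q (r ℚ.- q) r-q>0 λ (N , le) → ℚ.<-irrefl refl
       (ℚ.<-≤-trans r<p (subst (p ℚ.≤_) (add-sub q r) (le N ℕ.≤-refl)))
  where
  open ℚSolver.+-*-Solver
  add-sub : ∀ q r → q ℚ.+ (r ℚ.- q) ≡ r
  add-sub = solve 2 (λ q r → q :+ (r :- q) := r) refl

-- The goal is a negation for each `ε`, so a doubly negated hypothesis is enough. One half of `ε`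
-- pays for the slack, the other for the tolerance inside `_≤_`.
≤-slack : ∀ x y → (∀ ε → 0ℚ ℚ.< ε → ¬ ¬ (x ≤ y + fromℚ ε)) → x ≤ y
≤-slack x y x≤y+ ε ε>0 k = x≤y+ (ε ℚ.* ½) (½-pos ε>0) λ x≤y+½ε →
  eventually-map (λ n le → ≤-halves (seq x n) (seq y n ℚ.+ ε ℚ.* ½) (seq y n) ε le ℚ.≤-refl)
    (x≤y+½ε (ε ℚ.* ½) (½-pos ε>0)) k

+-monoˡ-≤ : ∀ x y z → x ≤ y → x + z ≤ y + z
+-monoˡ-≤ x y z x≤y ε ε>0 = eventually-map
  (λ n le → subst (seq x n ℚ.+ seq z n ℚ.≤_) (exchange (seq y n) ε (seq z n))
                  (ℚ.+-monoˡ-≤ (seq z n) le))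
  (x≤y ε ε>0)
  where
  open ℚSolver.+-*-Solver
  exchange : ∀ a b c → a ℚ.+ b ℚ.+ c ≡ a ℚ.+ c ℚ.+ b
  exchange = solve 3 (λ a b c → a :+ b :+ c := a :+ c :+ b) refl

seq-approximates : ∀ x ε → 0ℚ ℚ.< ε → Eventually λ N →
  fromℚ (seq x N ℚ.- ε) ≤ x × x ≤ fromℚ (seq x N ℚ.+ ε)
seq-approximates x ε ε>0 k = cauchy x ε ε>0 λ (M , close) →
  k (M , λ N M≤N →
    (λ δ δ>0 k′ → k′ (M , λ n M≤n → ℚ.≤-trans
       (subst (seq x N ℚ.- ε ℚ.≤_) (p+q-q≡p (seq x n) ε)
         (ℚ.+-monoˡ-≤ (ℚ.- ε) (near close M≤N M≤n)))
       (p≤p+ε (seq x n) (ℚ.<⇒≤ δ>0)))) ,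
    (λ δ δ>0 k′ → k′ (M , λ n M≤n → ℚ.≤-trans (near close M≤n M≤N)
       (p≤p+ε (seq x N ℚ.+ ε) (ℚ.<⇒≤ δ>0)))))
  where
  open ℚSolver.+-*-Solver
  split : ∀ a b → b ℚ.+ (a ℚ.- b) ≡ a
  split = solve 2 (λ a b → b :+ (a :- b) := a) refl
  near : ∀ {M m n} →
         (∀ m n → M ℕ.≤ m → M ℕ.≤ n → ∣ seq x m ℚ.- seq x n ∣ ℚ.≤ ε) →
         M ℕ.≤ m → M ℕ.≤ n → seq x m ℚ.≤ seq x n ℚ.+ ε
  near {m = m} {n} close M≤m M≤n =
    subst (ℚ._≤ seq x n ℚ.+ ε) (split (seq x m) (seq x n))
      (ℚ.+-monoʳ-≤ (seq x n) (ℚ.≤-trans (p≤∣p∣ (seq x m ℚ.- seq x n)) (close m n M≤m M≤n)))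

half-shift : ∀ a ε → a ℚ.- ε ℚ.* ½ ℚ.+ ε ≡ a ℚ.+ ε ℚ.* ½
half-shift a ε = trans (cong (a ℚ.- ε ℚ.* ½ ℚ.+_) (sym (½+½ ε)))
  (solve 2 (λ a h → a :- h :+ (h :+ h) := a :+ h) refl a (ε ℚ.* ½))
  where open ℚSolver.+-*-Solver

≤-fromBelow : ∀ x y → 0ℝ ≤ x → (∀ q → 0ℚ ℚ.≤ q → fromℚ q ≤ x → fromℚ q ≤ y) → x ≤ y
≤-fromBelow x y x≥0 below = ≤-slack x y λ ε ε>0 ¬goal →
  seq-approximates x (ε ℚ.* ½) (½-pos ε>0) λ (N , approx) →
  let lower , upper = approx N ℕ.≤-refl
      -- `q₀` lies below `x` but may be negative, while only nonnegative rationals may be tested;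
      -- its maximum with zero is still below `x` because `0ℝ ≤ x`.
      q₀ = seq x N ℚ.- ε ℚ.* ½
      q≤y : fromℚ (q₀ ℚ.⊔ 0ℚ) ≤ y
      q≤y = below (q₀ ℚ.⊔ 0ℚ) (ℚ.p≤q⊔p q₀ 0ℚ) (join q₀ (ℚ.≤-total q₀ 0ℚ) lower)
  in ¬goal (≤-trans x (fromℚ (seq x N ℚ.+ ε ℚ.* ½)) (y + fromℚ ε) upper
       (≤-trans (fromℚ (seq x N ℚ.+ ε ℚ.* ½)) (fromℚ (q₀ ℚ.⊔ 0ℚ) + fromℚ ε) (y + fromℚ ε)
       (pointwise-≤ (fromℚ (seq x N ℚ.+ ε ℚ.* ½)) (fromℚ (q₀ ℚ.⊔ 0ℚ) + fromℚ ε) λ _ →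
         subst (ℚ._≤ (q₀ ℚ.⊔ 0ℚ) ℚ.+ ε) (half-shift (seq x N) ε)
           (ℚ.+-monoˡ-≤ ε (ℚ.p≤p⊔q q₀ 0ℚ)))
       (+-monoˡ-≤ (fromℚ (q₀ ℚ.⊔ 0ℚ)) y (fromℚ ε) q≤y)))
  where
  join : ∀ q → q ℚ.≤ 0ℚ ⊎ 0ℚ ℚ.≤ q → fromℚ q ≤ x → fromℚ (q ℚ.⊔ 0ℚ) ≤ x
  join q (inj₁ q≤0) _   = subst (λ r → fromℚ r ≤ x) (sym (ℚ.p≤q⇒p⊔q≡q q≤0)) x≥0
  join q (inj₂ q≥0) q≤x = subst (λ r → fromℚ r ≤ x) (sym (ℚ.p≥q⇒p⊔q≡p q≥0)) q≤x

≤-fromAbove : ∀ x y →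
  (∀ ε → 0ℚ ℚ.< ε → Eventually λ n → x ≤ fromℚ (seq y n ℚ.+ ε)) → x ≤ y
≤-fromAbove x y above = ≤-slack x y λ ε ε>0 ¬goal →
  eventually-× (above (ε ℚ.* ½) (½-pos ε>0)) (seq-approximates y (ε ℚ.* ½) (½-pos ε>0))
    λ (N , h) → let x≤ , lower , _ = h N ℕ.≤-refl in
    ¬goal (≤-trans x (fromℚ (seq y N ℚ.+ ε ℚ.* ½)) (y + fromℚ ε) x≤
      (≤-trans (fromℚ (seq y N ℚ.+ ε ℚ.* ½)) (fromℚ (seq y N ℚ.- ε ℚ.* ½) + fromℚ ε) (y + fromℚ ε)
      (pointwise-≤ (fromℚ (seq y N ℚ.+ ε ℚ.* ½)) (fromℚ (seq y N ℚ.- ε ℚ.* ½) + fromℚ ε)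
        λ _ → ℚ.≤-reflexive (sym (half-shift (seq y N) ε)))
      (+-monoˡ-≤ (fromℚ (seq y N ℚ.- ε ℚ.* ½)) y (fromℚ ε) lower)))

limit-≥ : ∀ ρ L x → ρ ⟶ L → (∀ k .{{_ : ℕ.NonZero k}} → x ≤ ρ k) → x ≤ L
limit-≥ ρ L x ρ⟶L x≤ρ = ≤-slack x L λ ε ε>0 ¬goal → ρ⟶L ε ε>0 λ (N , close) →
  ¬goal (≤-trans x (ρ (ℕ.suc N)) (L + fromℚ ε) (x≤ρ (ℕ.suc N)) (proj₁ (close (ℕ.suc N) (ℕ.n≤1+n N))))

-- The multiples of `p` are cofinal, `suc N * p` being at least `N`, so a bound along them bounds
-- the limit. This is how a certificate for one power controls the limit.
limit-≤ : ∀ ρ L x p .{{_ : ℕ.NonZero p}} → ρ ⟶ L →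
          (∀ j → ρ (ℕ.suc j ℕ.* p) ≤ x) → L ≤ x
limit-≤ ρ L x p ρ⟶L ρ≤x = ≤-slack L x λ ε ε>0 ¬goal → ρ⟶L ε ε>0 λ (N , close) →
  ¬goal (≤-trans L (ρ (ℕ.suc N ℕ.* p) + fromℚ ε) (x + fromℚ ε)
    (proj₂ (close (ℕ.suc N ℕ.* p) (ℕ.≤-trans (ℕ.n≤1+n N) (ℕ.m≤m*n (ℕ.suc N) p))))
    (+-monoˡ-≤ (ρ (ℕ.suc N ℕ.* p)) x (fromℚ ε) (ρ≤x N)))

-- Powers and roots

seq-^ : ∀ x k n → seq (x ^ k) n ≡ seq x n ^ℚ k
seq-^ x ℕ.zero    n = refl
seq-^ x (ℕ.suc k) n = cong (seq x n ℚ.*_) (seq-^ x k n)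

^-mono-≤ : ∀ {p q} k → 0ℚ ℚ.≤ p → p ℚ.≤ q → p ^ℚ k ℚ.≤ q ^ℚ k
^-mono-≤ ℕ.zero    p≥0 p≤q = ℚ.≤-refl
^-mono-≤ (ℕ.suc k) p≥0 p≤q =
  *-mono-≤ (^-nonNeg k p≥0) (ℚ.≤-trans p≥0 p≤q) p≤q (^-mono-≤ k p≥0 p≤q)

^-pos : ∀ {p} k → 0ℚ ℚ.< p → 0ℚ ℚ.< p ^ℚ k
^-pos ℕ.zero    p>0 = ℚ.positive⁻¹ 1ℚ
^-pos {p} (ℕ.suc k) p>0 = subst (ℚ._< p ℚ.* p ^ℚ k) (ℚ.*-zeroʳ p)
  (ℚ.*-monoʳ-<-pos p {{ℚ.positive p>0}} (^-pos k p>0))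

-- This supplies the gap that comparing roots requires: `(q + ε) ^ k` exceeds `q ^ k` by at least
-- `ε ^ k`. It fails for `k = 0`.
^-superadditive : ∀ {p q} k .{{_ : ℕ.NonZero k}} → 0ℚ ℚ.≤ p → 0ℚ ℚ.≤ q →
                  p ^ℚ k ℚ.+ q ^ℚ k ℚ.≤ (p ℚ.+ q) ^ℚ k
^-superadditive {p} {q} (ℕ.suc k) p≥0 q≥0 =
  ℚ.≤-trans (ℚ.+-mono-≤ (grow p p≥0 (p≤p+ε p q≥0))
                        (grow q q≥0 (subst (q ℚ.≤_) (ℚ.+-comm q p) (p≤p+ε q p≥0))))
            (ℚ.≤-reflexive (sym (ℚ.*-distribʳ-+ ((p ℚ.+ q) ^ℚ k) p q)))
  where
  grow : ∀ r → 0ℚ ℚ.≤ r → r ℚ.≤ p ℚ.+ q → r ^ℚ ℕ.suc k ℚ.≤ r ℚ.* (p ℚ.+ q) ^ℚ k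
  grow r r≥0 r≤ = ℚ.*-monoˡ-≤-nonNeg r {{ℚ.nonNegative r≥0}} (^-mono-≤ k r≥0 r≤)

∣∣≤⇒^≤ : ∀ {p q} k → ∣ p ∣ ℚ.≤ q → p ^ℚ k ℚ.≤ q ^ℚ k
∣∣≤⇒^≤ {p} {q} k ∣p∣≤q =
  ℚ.≤-trans (p≤∣p∣ (p ^ℚ k)) (ℚ.≤-trans (ℚ.≤-reflexive (∣^∣ k)) (^-mono-≤ k (ℚ.0≤∣p∣ p) ∣p∣≤q))
  where
  ∣^∣ : ∀ k → ∣ p ^ℚ k ∣ ≡ ∣ p ∣ ^ℚ k
  ∣^∣ ℕ.zero    = refl
  ∣^∣ (ℕ.suc k) = trans (ℚ.∣p*q∣≡∣p∣*∣q∣ p (p ^ℚ k)) (cong (∣ p ∣ ℚ.*_) (∣^∣ k))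

module _ {k v r} .{{_ : ℕ.NonZero k}} (root : IsRoot k v r) {q} (q≥0 : 0ℚ ℚ.≤ q) where

  -- If a late term of `r` exceeded `q + ε`, its `k`-th power would exceed `q ^ k` by at least
  -- `ε ^ k`, but the tolerance there is half of that.
  root-≤ : v ≤ fromℚ (q ^ℚ k) → r ≤ fromℚ q
  root-≤ v≤ ε ε>0 = eventually-map
    (λ n rᵏ≤ → ℚ.≮⇒≥ λ q+ε<r → ℚ.<-irrefl refl (ℚ.<-≤-trans
       (strict (ℚ.<⇒≤ q+ε<r))
       (subst (ℚ._≤ q ^ℚ k ℚ.+ ε ^ℚ k ℚ.* ½) (seq-^ r k n) rᵏ≤)))
    (≤-trans (r ^ k) v (fromℚ (q ^ℚ k)) (proj₁ (proj₂ root)) v≤ (ε ^ℚ k ℚ.* ½) (½-pos (^-pos k ε>0)))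
    where
    q+ε≥0 = +-nonNeg q≥0 (ℚ.<⇒≤ ε>0)
    strict : ∀ {s} → q ℚ.+ ε ℚ.≤ s → q ^ℚ k ℚ.+ ε ^ℚ k ℚ.* ½ ℚ.< s ^ℚ k
    strict le = ℚ.<-≤-trans (ℚ.+-monoʳ-< (q ^ℚ k) (half< (^-pos k ε>0)))
      (ℚ.≤-trans (^-superadditive k q≥0 (ℚ.<⇒≤ ε>0)) (^-mono-≤ k q+ε≥0 le))

  root-≥ : fromℚ (q ^ℚ k) ≤ v → fromℚ q ≤ r
  root-≥ ≤v ε ε>0 = eventually-map
    (λ n (r≥ , qᵏ≤) → ℚ.≮⇒≥ λ r+ε<q → ℚ.<-irrefl refl (ℚ.<-≤-trans
       (strict {seq r n} r≥ (ℚ.<⇒≤ r+ε<q))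
       (subst (λ p → q ^ℚ k ℚ.≤ p ℚ.+ δ) (seq-^ r k n) qᵏ≤)))
    (eventually-× (proj₁ root (ε ℚ.* ½ ℚ.* ½) (½-pos (½-pos ε>0)))
                  (≤-trans (fromℚ (q ^ℚ k)) v (r ^ k) ≤v (proj₂ (proj₂ root)) δ (½-pos (^-pos k (½-pos ε>0)))))
    where
    h = ε ℚ.* ½ ℚ.* ½
    δ = (ε ℚ.* ½) ^ℚ k ℚ.* ½
    -- A term s of the sequence may be slightly negative, so sᵏ is compared with (s + ε/2)ᵏ.
    strict : ∀ {s} → 0ℚ ℚ.≤ s ℚ.+ h → s ℚ.+ ε ℚ.≤ q → s ^ℚ k ℚ.+ δ ℚ.< q ^ℚ k
    strict {s} s+h≥0 s+ε≤q = ℚ.<-≤-trans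
      (ℚ.+-mono-≤-< (∣∣≤⇒^≤ k ∣s∣≤) (half< (^-pos k (½-pos ε>0))))
      (ℚ.≤-trans (^-superadditive k s′≥0 (ℚ.<⇒≤ (½-pos ε>0)))
        (^-mono-≤ k (+-nonNeg s′≥0 (ℚ.<⇒≤ (½-pos ε>0)))
          (ℚ.≤-trans (ℚ.≤-reflexive (trans (ℚ.+-assoc s (ε ℚ.* ½) (ε ℚ.* ½)) (cong (s ℚ.+_) (½+½ ε)))) s+ε≤q)))
      where
      s′ = s ℚ.+ ε ℚ.* ½
      h≥0 = ℚ.<⇒≤ (½-pos (½-pos ε>0))
      s+h+h : s ℚ.+ h ℚ.+ h ≡ s′
      s+h+h = trans (ℚ.+-assoc s h h) (cong (s ℚ.+_) (½+½ (ε ℚ.* ½)))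
      s′≥0 : 0ℚ ℚ.≤ s′
      s′≥0 = subst (0ℚ ℚ.≤_) s+h+h (+-nonNeg s+h≥0 h≥0)
      neg≤ : ℚ.- s ℚ.≤ s′
      neg≤ = subst₂ ℚ._≤_ (ℚ.+-identityˡ (ℚ.- s)) (trans (lemma s h) s+h+h)
        (ℚ.+-monoˡ-≤ (ℚ.- s) (+-nonNeg s+h≥0 s+h≥0))
        where
        open ℚSolver.+-*-Solver
        lemma : ∀ s h → s ℚ.+ h ℚ.+ (s ℚ.+ h) ℚ.- s ≡ s ℚ.+ h ℚ.+ h
        lemma = solve 2 (λ s h → s :+ h :+ (s :+ h) :- s := s :+ h :+ h) refl
      ∣s∣≤ : ∣ s ∣ ℚ.≤ s′
      ∣s∣≤ with ℚ.∣p∣≡p∨∣p∣≡-p s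
      ... | inj₁ eq = ℚ.≤-trans (ℚ.≤-reflexive eq) (p≤p+ε s (ℚ.<⇒≤ (½-pos ε>0)))
      ... | inj₂ eq = ℚ.≤-trans (ℚ.≤-reflexive eq) neg≤

-- Bicliques and families of rectangles

does⁺ : ∀ {X : Set} (X? : Dec X) → X → does X? ≡ true
does⁺ (yes _) x = refl
does⁺ (no ¬x) x = ⊥-elim (¬x x)

does⁻ : ∀ {X : Set} (X? : Dec X) → does X? ≡ true → X
does⁻ (yes x) _ = x

∈-tabulate⁺ : ∀ {n} (u : Fin n → Bool) i → u i ≡ true → i ∈ Vec.tabulate u
∈-tabulate⁺ u i ui = Vec.lookup⇒[]= i (Vec.tabulate u) (trans (Vec.lookup∘tabulate u i) ui)

∈-tabulate⁻ : ∀ {n} (u : Fin n → Bool) {i} → i ∈ Vec.tabulate u → u i ≡ true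
∈-tabulate⁻ u {i} i∈ = trans (sym (Vec.lookup∘tabulate u i)) (Vec.[]=⇒lookup i∈)

∈?-tabulate : ∀ {n} (u : Fin n → Bool) i → does (i ∈? Vec.tabulate u) ≡ u i
∈?-tabulate u i with u i in eq
... | true  = does⁺ (i ∈? Vec.tabulate u) (∈-tabulate⁺ u i eq)
... | false with i ∈? Vec.tabulate u
...   | yes i∈ = trans (sym (∈-tabulate⁻ u i∈)) eq
...   | no _   = refl

∈-subsets : ∀ {n} (U : Subset n) → U ∈ˡ subsets n
∈-subsets []            = here refl
∈-subsets (outside ∷ U) =
  ∈-cartesianProductWith⁺ _∷_ {xs = outside ∷ inside ∷ []} (here refl) (∈-subsets U)
∈-subsets (inside ∷ U)  =
  ∈-cartesianProductWith⁺ _∷_ {xs = outside ∷ inside ∷ []} (there (here refl)) (∈-subsets U)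

seq-sum : ∀ {N} (x : Fin N → ℝ) n → seq (sum x) n ≡ ∑ (allFin N) (λ b → seq (x b) n)
seq-sum {ℕ.zero}  x n = refl
seq-sum {ℕ.suc N} x n = trans (cong (seq (x zero) n ℚ.+_) (seq-sum (x ∘ suc) n))
  (sym (∑-allFin N (λ b → seq (x b) n)))

≤∧≢⇒< : ∀ {p} → 0ℚ ℚ.≤ p → p ≢ 0ℚ → 0ℚ ℚ.< p
≤∧≢⇒< {p} p≥0 p≢0 = ℚ.positive⁻¹ p
  {{ℚ.nonNeg∧nonZero⇒pos p {{ℚ.nonNegative p≥0}} {{ℚ.≢-nonZero p≢0}}}}

inverse : ∀ {p} → 0ℚ ℚ.< p → ∃ λ r → 0ℚ ℚ.< r × p ℚ.* r ≡ 1ℚ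
inverse {p} p>0 = ℚ.1/ p , ℚ.positive⁻¹ (ℚ.1/ p) {{ℚ.1/pos⇒pos p}} , ℚ.*-inverseʳ p
  where
  instance
    p⁺ = ℚ.positive p>0
    p≢0 = ℚ.pos⇒nonZero p

-- `δ` is the error of a rational family that follows a real cover: it covers at level `1 - δ`, and
-- its total `t` exceeds the term `s` of the real total by at most `δ`.
Tolerance : ℚ → ℚ → ℚ → Set
Tolerance q ε δ = 0ℚ ℚ.< δ × 0ℚ ℚ.≤ 1ℚ ℚ.- δ ×
  (∀ s t → (1ℚ ℚ.- δ) ℚ.* q ℚ.≤ t → t ℚ.≤ s ℚ.+ δ → q ℚ.≤ s ℚ.+ ε)

tolerance : ∀ {q ε} → 0ℚ ℚ.≤ q → 0ℚ ℚ.< ε → ∃ (Tolerance q ε)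
tolerance {q} {ε} q≥0 ε>0 = from (inverse S>0)
  where
  -- The choice `δ = ε / (ε + q + 1)` gives `δ ≤ 1` and `δ q + δ ≤ ε` at once.
  S = ε ℚ.+ (q ℚ.+ 1ℚ)
  q+1≥0 = +-nonNeg q≥0 0≤1
  S>0 : 0ℚ ℚ.< S
  S>0 = ℚ.+-mono-<-≤ ε>0 q+1≥0
  open ℚSolver.+-*-Solver
  excess : ∀ e p r → p ℚ.* r ≡ (e ℚ.+ p) ℚ.* r ℚ.- e ℚ.* r
  excess = solve 3 (λ e p r → p :* r := (e :+ p) :* r :- e :* r) refl
  collect : ∀ u d q → (u ℚ.- d) ℚ.* q ℚ.+ d ℚ.* q ≡ u ℚ.* q
  collect = solve 3 (λ u d q → (u :- d) :* q :+ d :* q := u :* q) refl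
  regroup : ∀ e r p s → s ℚ.+ e ℚ.* r ℚ.+ e ℚ.* r ℚ.* p ≡ s ℚ.+ e ℚ.* (r ℚ.* p ℚ.+ r)
  regroup = solve 4 (λ e r p s → s :+ e :* r :+ e :* r :* p := s :+ e :* (r :* p :+ r)) refl
  from : (∃ λ r → 0ℚ ℚ.< r × S ℚ.* r ≡ 1ℚ) → ∃ (Tolerance q ε)
  from (r , r>0 , Sr≡1) = ε ℚ.* r , δ>0 , 1-δ≥0 , close
    where
    r≥0 = ℚ.<⇒≤ r>0
    ε≥0 = ℚ.<⇒≤ ε>0
    δ>0 : 0ℚ ℚ.< ε ℚ.* r
    δ>0 = subst (ℚ._< ε ℚ.* r) (ℚ.*-zeroˡ r) (ℚ.*-monoˡ-<-pos r {{ℚ.positive r>0}} ε>0)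
    1-δ≥0 : 0ℚ ℚ.≤ 1ℚ ℚ.- ε ℚ.* r
    1-δ≥0 = subst (0ℚ ℚ.≤_) (trans (excess ε (q ℚ.+ 1ℚ) r) (cong (ℚ._- ε ℚ.* r) Sr≡1))
      (*-nonNeg q+1≥0 r≥0)
    rq+r≤1 : r ℚ.* q ℚ.+ r ℚ.≤ 1ℚ
    rq+r≤1 = begin
      r ℚ.* q ℚ.+ r          ≡⟨ cong (r ℚ.* q ℚ.+_) (ℚ.*-identityʳ r) ⟨
      r ℚ.* q ℚ.+ r ℚ.* 1ℚ   ≡⟨ ℚ.*-distribˡ-+ r q 1ℚ ⟨
      r ℚ.* (q ℚ.+ 1ℚ)       ≤⟨ ℚ.*-monoˡ-≤-nonNeg r {{ℚ.nonNegative r≥0}} q+1≤S ⟩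
      r ℚ.* S                ≡⟨ ℚ.*-comm r S ⟩
      S ℚ.* r                ≡⟨ Sr≡1 ⟩
      1ℚ                     ∎
      where
      open ℚ.≤-Reasoning
      q+1≤S : q ℚ.+ 1ℚ ℚ.≤ S
      q+1≤S = subst (q ℚ.+ 1ℚ ℚ.≤_) (ℚ.+-comm (q ℚ.+ 1ℚ) ε) (p≤p+ε (q ℚ.+ 1ℚ) ε≥0)
    close : ∀ s t → (1ℚ ℚ.- ε ℚ.* r) ℚ.* q ℚ.≤ t → t ℚ.≤ s ℚ.+ ε ℚ.* r → q ℚ.≤ s ℚ.+ ε
    close s t ≤t t≤ = begin
      q                                                ≡⟨ ℚ.*-identityˡ q ⟨
      1ℚ ℚ.* q                                         ≡⟨ collect 1ℚ (ε ℚ.* r) q ⟨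
      (1ℚ ℚ.- ε ℚ.* r) ℚ.* q ℚ.+ ε ℚ.* r ℚ.* q         ≤⟨ ℚ.+-monoˡ-≤ (ε ℚ.* r ℚ.* q) (ℚ.≤-trans ≤t t≤) ⟩
      s ℚ.+ ε ℚ.* r ℚ.+ ε ℚ.* r ℚ.* q                  ≡⟨ regroup ε r q s ⟩
      s ℚ.+ ε ℚ.* (r ℚ.* q ℚ.+ r)                      ≤⟨ ℚ.+-monoʳ-≤ s (ℚ.*-monoˡ-≤-nonNeg ε
                                                            {{ℚ.nonNegative ε≥0}} rq+r≤1) ⟩
      s ℚ.+ ε ℚ.* 1ℚ                                   ≡⟨ cong (s ℚ.+_) (ℚ.*-identityʳ ε) ⟩
      s ℚ.+ ε                                          ∎
      where open ℚ.≤-Reasoning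

split-evenly : ∀ N {δ} → 0ℚ ℚ.< δ → ∃ λ η → 0ℚ ℚ.< η × ι N ℚ.* η ℚ.≤ δ
split-evenly N {δ} δ>0 = δ ℚ.* r , η>0 , (begin
  ι N ℚ.* (δ ℚ.* r)         ≤⟨ ℚ.*-monoʳ-≤-nonNeg (δ ℚ.* r) {{ℚ.nonNegative (ℚ.<⇒≤ η>0)}}
                                 (ι-mono (ℕ.n≤1+n N)) ⟩
  ι (ℕ.suc N) ℚ.* (δ ℚ.* r) ≡⟨ rearrange (ι (ℕ.suc N)) δ r ⟩
  δ ℚ.* (ι (ℕ.suc N) ℚ.* r) ≡⟨ cong (δ ℚ.*_) (ι-/ 1 (ℕ.suc N)) ⟩
  δ ℚ.* 1ℚ                  ≡⟨ ℚ.*-identityʳ δ ⟩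
  δ                         ∎)
  where
  open ℚ.≤-Reasoning
  open ℚSolver.+-*-Solver
  -- The divisor is `suc N` so that it is nonzero also for `N = 0`.
  r = ℤ.+ 1 ℚ./ ℕ.suc N
  η>0 : 0ℚ ℚ.< δ ℚ.* r
  η>0 = subst (ℚ._< δ ℚ.* r) (ℚ.*-zeroˡ r)
    (ℚ.*-monoˡ-<-pos r {{ℚ.normalize-pos 1 (ℕ.suc N)}} δ>0)
  rearrange : ∀ a b c → a ℚ.* (b ℚ.* c) ≡ b ℚ.* (a ℚ.* c)
  rearrange = solve 3 (λ a b c → a :* (b :* c) := b :* (a :* c)) refl

module _ {n m} (A : BinMatrix n m) where

  private N = #bicliques A

  biclique : Fin N → Subset n × Subset m
  biclique = List.lookup (bicliques A)

  row∈ : Fin N → Fin n → Bool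
  row∈ b i = does (i ∈? proj₁ (biclique b))

  col∈ : Fin N → Fin m → Bool
  col∈ b j = does (j ∈? proj₂ (biclique b))

  biclique-allOnes : ∀ b i j → row∈ b i ≡ true → col∈ b j ≡ true → A i j ≡ true
  biclique-allOnes b i j r c =
    let _ , _ , ones = proj₂ (∈-filter⁻ (isBiclique? A)
                         {xs = cartesianProduct (subsets n) (subsets m)}
                         (∈-lookup {xs = bicliques A} b))
    in ones i j (does⁻ (i ∈? proj₁ (biclique b)) r) (does⁻ (j ∈? proj₂ (biclique b)) c)

  bicliqueFamily : (z : Fin N → ℚ) → (∀ b → 0ℚ ℚ.≤ z b) → Family A
  bicliqueFamily z z≥0 = record
    { indices  = allFin N
    ; weight   = z
    ; rows     = row∈
    ; cols     = col∈
    ; weight≥0 = z≥0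
    ; allOnes  = biclique-allOnes
    }

  seq-M· : ∀ x i j k →
    seq ((M·_ A x) i j) k ≡ ∑ (allFin N) (λ b → seq (x b) k ℚ.* 𝟙[ row∈ b i ∧ col∈ b j ])
  seq-M· x i j k = trans (seq-sum (λ b → incidence A i j b * x b) k)
    (∑-cong (allFin N) λ b →
      trans (cong (ℚ._* seq (x b) k) (seq-if (row∈ b i ∧ col∈ b j))) (ℚ.*-comm _ (seq (x b) k)))
    where
    seq-if : ∀ c → seq (if c then 1ℝ else 0ℝ) k ≡ 𝟙[ c ]
    seq-if true  = refl
    seq-if false = refl

  -- Empty rectangles are dropped, so the total may decrease.
  module _ (F : Family A) where

    private
      Realised : List (Index F) → (Fin N → ℚ) → Set
      Realised xs y =
          (∀ b → 0ℚ ℚ.≤ y b)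
        × (∀ i j → ∑ (allFin N) (λ b → y b ℚ.* 𝟙[ row∈ b i ∧ col∈ b j ])
                   ≡ ∑ xs (λ x → weight F x ℚ.* 𝟙[ rows F x i ∧ cols F x j ]))
        × ∑ (allFin N) y ℚ.≤ ∑ xs (weight F)

      RowsOf : Index F → Subset n
      RowsOf x = Vec.tabulate (rows F x)
      ColsOf : Index F → Subset m
      ColsOf x = Vec.tabulate (cols F x)

      find : ∀ x i j → rows F x i ≡ true → cols F x j ≡ true →
             ∃ λ b → biclique b ≡ (RowsOf x , ColsOf x)
      find x i j r c = index x∈ , sym (Any.lookup-index x∈)
        where
        x∈ : (RowsOf x , ColsOf x) ∈ˡ bicliques A
        x∈ = ∈-filter⁺ (isBiclique? A) (∈-cartesianProduct⁺ (∈-subsets _) (∈-subsets _))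
          ( (i , ∈-tabulate⁺ (rows F x) i r) , (j , ∈-tabulate⁺ (cols F x) j c)
          , λ i j i∈ j∈ → allOnes F x i j (∈-tabulate⁻ (rows F x) i∈) (∈-tabulate⁻ (cols F x) j∈))

      -- The weight of `x` is added at the position `b` of its biclique, where weight may already
      -- stand, since several indices can carry the same rectangle.
      add : ∀ x xs {y} b → biclique b ≡ (RowsOf x , ColsOf x) → Realised xs y →
            Realised (x ∷ xs) λ c → weight F x ℚ.* 𝟙[ does (b Fin.≟ c) ] ℚ.+ y c
      add x xs {y} b b≡x (y≥0 , cov , tot) =
          (λ c → +-nonNeg (*-nonNeg (weight≥0 F x) (𝟙-nonNeg _)) (y≥0 c))
        , (λ i j → begin
            ∑ (allFin N) (λ c → (w ℚ.* 𝟙[ does (b Fin.≟ c) ] ℚ.+ y c) ℚ.* in? c i j)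
              ≡⟨ ∑-cong (allFin N) (λ c → expand 𝟙[ does (b Fin.≟ c) ] (y c) (in? c i j)) ⟩
            ∑ (allFin N) (λ c → w ℚ.* in? c i j ℚ.* 𝟙[ does (b Fin.≟ c) ] ℚ.+ y c ℚ.* in? c i j)
              ≡⟨ ∑-+ (allFin N) ⟩
            ∑ (allFin N) (λ c → w ℚ.* in? c i j ℚ.* 𝟙[ does (b Fin.≟ c) ])
              ℚ.+ ∑ (allFin N) (λ c → y c ℚ.* in? c i j)
              ≡⟨ cong₂ ℚ._+_ (trans (∑-δ (λ c → w ℚ.* in? c i j) b) (cong (w ℚ.*_) (in?-b i j)))
                   (cov i j) ⟩
            w ℚ.* 𝟙[ rows F x i ∧ cols F x j ]
              ℚ.+ ∑ xs (λ x → weight F x ℚ.* 𝟙[ rows F x i ∧ cols F x j ])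
              ∎)
        , ℚ.≤-trans (ℚ.≤-reflexive (trans (∑-+ (allFin N)) (cong (ℚ._+ ∑ (allFin N) y) (∑-δ (λ _ → w) b))))
            (ℚ.+-monoʳ-≤ w tot)
        where
        open ≡-Reasoning
        w = weight F x
        in? : Fin N → Fin n → Fin m → ℚ
        in? c i j = 𝟙[ row∈ c i ∧ col∈ c j ]
        in?-b : ∀ i j → in? b i j ≡ 𝟙[ rows F x i ∧ cols F x j ]
        in?-b i j = cong 𝟙[_] (cong₂ _∧_
          (trans (cong (λ R → does (i ∈? proj₁ R)) b≡x) (∈?-tabulate (rows F x) i))
          (trans (cong (λ R → does (j ∈? proj₂ R)) b≡x) (∈?-tabulate (cols F x) j)))
        expand : ∀ d y e → (w ℚ.* d ℚ.+ y) ℚ.* e ≡ w ℚ.* e ℚ.* d ℚ.+ y ℚ.* e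
        expand = solve 4 (λ w d y e → (w :* d :+ y) :* e := w :* e :* d :+ y :* e) refl w
          where open ℚSolver.+-*-Solver

      drop : ∀ x xs {y} → (∀ i j → rows F x i ∧ cols F x j ≡ false) → Realised xs y →
             Realised (x ∷ xs) y
      drop x xs {y} empty (y≥0 , cov , tot) =
          y≥0
        , (λ i j → trans (cov i j) (sym (trans
            (cong (ℚ._+ _) (trans (cong (λ b → weight F x ℚ.* 𝟙[ b ]) (empty i j)) (ℚ.*-zeroʳ (weight F x))))
            (ℚ.+-identityˡ _))))
        , ℚ.≤-trans tot (subst (ℚ._≤ weight F x ℚ.+ ∑ xs (weight F)) (ℚ.+-identityˡ _)
            (ℚ.+-monoˡ-≤ (∑ xs (weight F)) (weight≥0 F x)))

      realised : ∀ xs → ∃ (Realised xs)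
      realised [] = (λ _ → 0ℚ) , (λ _ → ℚ.≤-refl)
        , (λ i j → trans (∑-cong (allFin N) λ b → ℚ.*-zeroˡ 𝟙[ row∈ b i ∧ col∈ b j ]) (∑-0 (allFin N)))
        , ℚ.≤-reflexive (∑-0 (allFin N))
      realised (x ∷ xs) with y , R ← realised xs
        with Fin.any? (λ i → rows F x i Bool.≟ true) | Fin.any? (λ j → cols F x j Bool.≟ true)
      ... | yes (i , r) | yes (j , c) = let b , b≡x = find x i j r c in _ , add x xs b b≡x R
      ... | no ¬r       | _           = y , drop x xs (λ i j → not-∧ˡ (λ r → ¬r (i , r))) R
        where
        not-∧ˡ : ∀ {a b} → ¬ a ≡ true → a ∧ b ≡ false
        not-∧ˡ {true}  ¬a = ⊥-elim (¬a refl)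
        not-∧ˡ {false} ¬a = refl
      ... | yes _       | no ¬c       = y , drop x xs (λ i j → not-∧ʳ (λ c → ¬c (j , c))) R
        where
        not-∧ʳ : ∀ {a b} → ¬ b ≡ true → a ∧ b ≡ false
        not-∧ʳ {a} {true}  ¬b = ⊥-elim (¬b refl)
        not-∧ʳ {a} {false} ¬b = Bool.∧-zeroʳ a

    weights : Fin N → ℝ
    weights b = fromℚ (proj₁ (realised (indices F)) b)

    weights-nonNegative : NonNegative A weights
    weights-nonNegative b = pointwise-≤ 0ℝ (weights b) λ _ → proj₁ (proj₂ (realised (indices F))) b

    M·weights : ∀ i j k → seq ((M·_ A weights) i j) k ≡ coverage F i j
    M·weights i j k =
      trans (seq-M· weights i j k) (proj₁ (proj₂ (proj₂ (realised (indices F)))) i j)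

    sum-weights : sum weights ≤ fromℚ (total F)
    sum-weights = pointwise-≤ (sum weights) (fromℚ (total F)) λ k →
      ℚ.≤-trans (ℚ.≤-reflexive (seq-sum weights k)) (proj₂ (proj₂ (proj₂ (realised (indices F)))))

  bpf≤total : ∀ v t → Is-bpf A v → PartitionOf A t → v ≤ fromℚ t
  bpf≤total v t (_ , minimal) (F , partition , tF) =
    ≤-trans v (sum (weights F)) (fromℚ t)
      (minimal (weights F)
        ( (λ i j Aij → pointwise-≃ ((M·_ A (weights F)) i j) 1ℝ λ k →
             trans (M·weights F i j k) (partition i j Aij))
        , weights-nonNegative F))
      (subst (λ t → sum (weights F) ≤ fromℚ t) tF (sum-weights F))

  -- Dividing the weights by `t` makes the family a cover, to which the minimality of `c` applies.
  -- For `t = 0` it suffices that totals are nonnegative.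
  bcf-lowerBound : ∀ c q → Is-bcf A c → fromℚ q ≤ c → LowerBound A q
  bcf-lowerBound c q (_ , minimal) q≤c F t t≥0 cov = cases (t ℚ.≟ 0ℚ)
    where
    rescale : (∃ λ r → 0ℚ ℚ.< r × t ℚ.* r ≡ 1ℚ) → t ℚ.* q ℚ.≤ total F
    rescale (r , r>0 , tr≡1) = ℚ.≤-trans (ℚ.*-monoˡ-≤-nonNeg t {{ℚ.nonNegative t≥0}} q≤)
      (ℚ.≤-reflexive (trans (sym (ℚ.*-assoc t r (total F)))
        (trans (cong (ℚ._* total F) tr≡1) (ℚ.*-identityˡ (total F)))))
      where
      r≥0 = ℚ.<⇒≤ r>0
      G = scale r r≥0 F
      cover : Cover A (weights G)
      cover i j Aij = pointwise-≤ 1ℝ ((M·_ A (weights G)) i j) λ k →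
        subst₂ ℚ._≤_ (trans (ℚ.*-comm r t) tr≡1)
          (sym (trans (M·weights G i j k) (coverage-scale r r≥0 F i j)))
          (ℚ.*-monoˡ-≤-nonNeg r {{ℚ.nonNegative r≥0}} (cov i j Aij))
      q≤ : q ℚ.≤ r ℚ.* total F
      q≤ = fromℚ-cancel-≤ q (r ℚ.* total F) (≤-trans (fromℚ q) c (fromℚ (r ℚ.* total F)) q≤c
        (≤-trans c (sum (weights G)) (fromℚ (r ℚ.* total F))
          (minimal (weights G) (cover , weights-nonNegative G))
          (subst (λ s → sum (weights G) ≤ fromℚ s) (total-scale r r≥0 F) (sum-weights G))))
    cases : Dec (t ≡ 0ℚ) → t ℚ.* q ℚ.≤ total F
    cases (yes t≡0) =
      ℚ.≤-trans (ℚ.≤-reflexive (trans (cong (ℚ._* q) t≡0) (ℚ.*-zeroˡ q))) (total≥0 F)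
    cases (no t≢0) = rescale (inverse (≤∧≢⇒< t≥0 t≢0))

  -- Shifting a term of the sequences by η > 0 turns a nonnegative real weight vector into a
  -- nonnegative rational one.
  module _ (x : Fin N → ℝ) {η δ : ℚ} (η>0 : 0ℚ ℚ.< η) (Nη≤δ : ι N ℚ.* η ℚ.≤ δ) where

    eventually-shift≥0 : NonNegative A x → Eventually λ n → ∀ b → 0ℚ ℚ.≤ seq (x b) n ℚ.+ η
    eventually-shift≥0 x≥0 = eventually-∀ λ b → x≥0 b η η>0

    private
      Ση≤δ : ∑ (allFin N) (λ _ → η) ℚ.≤ δ
      Ση≤δ = subst (ℚ._≤ δ) (sym (∑-allFin-const N η)) Nη≤δ

    module _ (k : ℕ) (shift≥0 : ∀ b → 0ℚ ℚ.≤ seq (x b) k ℚ.+ η) where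

      shifted : Family A
      shifted = bicliqueFamily (λ b → seq (x b) k ℚ.+ η) shift≥0

      total-shifted : total shifted ℚ.≤ seq (sum x) k ℚ.+ δ
      total-shifted = ℚ.≤-trans (ℚ.≤-reflexive (∑-+ (allFin N) {λ b → seq (x b) k} {λ _ → η}))
        (ℚ.+-mono-≤ (ℚ.≤-reflexive (sym (seq-sum x k))) Ση≤δ)

      private
        coverage-shifted : ∀ i j → coverage shifted i j ≡
          seq ((M·_ A x) i j) k ℚ.+ ∑ (allFin N) (λ b → η ℚ.* 𝟙[ row∈ b i ∧ col∈ b j ])
        coverage-shifted i j = trans
          (∑-cong (allFin N) λ b → ℚ.*-distribʳ-+ 𝟙[ row∈ b i ∧ col∈ b j ] (seq (x b) k) η)
          (trans (∑-+ (allFin N) {λ b → seq (x b) k ℚ.* 𝟙[ row∈ b i ∧ col∈ b j ]})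
                 (cong (ℚ._+ ∑ (allFin N) (λ b → η ℚ.* 𝟙[ row∈ b i ∧ col∈ b j ]))
                       (sym (seq-M· x i j k))))

      coverage-shifted-≥ : ∀ i j → seq ((M·_ A x) i j) k ℚ.≤ coverage shifted i j
      coverage-shifted-≥ i j = subst (seq ((M·_ A x) i j) k ℚ.≤_) (sym (coverage-shifted i j))
        (p≤p+ε (seq ((M·_ A x) i j) k)
          (∑-nonNeg (allFin N) λ b → *-nonNeg (ℚ.<⇒≤ η>0) (𝟙-nonNeg (row∈ b i ∧ col∈ b j))))

      coverage-shifted-≤ : ∀ i j → coverage shifted i j ℚ.≤ seq ((M·_ A x) i j) k ℚ.+ δ
      coverage-shifted-≤ i j = subst (ℚ._≤ seq ((M·_ A x) i j) k ℚ.+ δ) (sym (coverage-shifted i j))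
        (ℚ.+-monoʳ-≤ (seq ((M·_ A x) i j) k) (ℚ.≤-trans
          (∑-mono (allFin N) {g = λ _ → η} λ b →
            subst (η ℚ.* 𝟙[ row∈ b i ∧ col∈ b j ] ℚ.≤_) (ℚ.*-identityʳ η)
            (ℚ.*-monoˡ-≤-nonNeg η {{ℚ.nonNegative (ℚ.<⇒≤ η>0)}} (𝟙≤1 (row∈ b i ∧ col∈ b j))))
          Ση≤δ))

  -- Late terms of `x`, shifted by `η`, cover at level `1 - δ`: shifting only raises the coverage,
  -- and it adds at most `δ` to the total. `Tolerance` converts these two errors into `ε`.
  lowerBound≤sum : ∀ {q} x → 0ℚ ℚ.≤ q → LowerBound A q → Cover A x → NonNegative A x →
                   fromℚ q ≤ sum x
  lowerBound≤sum {q} x q≥0 lb cover x≥0 ε ε>0 =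
    bound (tolerance q≥0 ε>0)
    where
    step : ∀ δ η → Tolerance q ε δ → 0ℚ ℚ.< η → ι N ℚ.* η ℚ.≤ δ →
           Eventually λ n → q ℚ.≤ seq (sum x) n ℚ.+ ε
    step δ η (δ>0 , 1-δ≥0 , close) η>0 Nη≤δ = eventually-map
      (λ n (shift≥0 , covers) →
        let F = shifted x η>0 Nη≤δ n shift≥0 in
        close (seq (sum x) n) (total F)
          (lb F (1ℚ ℚ.- δ) 1-δ≥0 λ i j Aij →
            ℚ.≤-trans (ℚ.≤-trans (ℚ.+-monoˡ-≤ (ℚ.- δ) (covers i j Aij))
                                 (ℚ.≤-reflexive (p+q-q≡p (seq ((M·_ A x) i j) n) δ)))
                      (coverage-shifted-≥ x η>0 Nη≤δ n shift≥0 i j))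
          (total-shifted x η>0 Nη≤δ n shift≥0))
      (eventually-× (eventually-shift≥0 x η>0 Nη≤δ x≥0)
        (eventually-∀ λ i → eventually-∀ λ j → eventually-→ λ Aij → cover i j Aij δ δ>0))
    spread : ∀ δ → Tolerance q ε δ → (∃ λ η → 0ℚ ℚ.< η × ι N ℚ.* η ℚ.≤ δ) →
             Eventually λ n → q ℚ.≤ seq (sum x) n ℚ.+ ε
    spread δ tol (η , η>0 , Nη≤δ) = step δ η tol η>0 Nη≤δ
    bound : ∃ (Tolerance q ε) → Eventually λ n → q ℚ.≤ seq (sum x) n ℚ.+ ε
    bound (δ , tol) = spread δ tol (split-evenly N (proj₁ tol))

-- Double counting of the pairs of an entry of `S` and a rectangle through it: two such entries in
-- one rectangle would lie in a common all-ones submatrix.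
isolation-lowerBound : ∀ {n m} {A : BinMatrix n m} {S} → IsIsolationSet A S →
                       LowerBound A (ι (length S))
isolation-lowerBound {A = A} {S} (uniq , ones , isolated) F t t≥0 cov = begin
  t ℚ.* ι (length S)
    ≡⟨ trans (∑-const S t) (ℚ.*-comm (ι (length S)) t) ⟨
  ∑ S (λ _ → t)
    ≤⟨ ∑-mono-∈ S (λ { {i , j} e∈ → cov i j (ones e∈) }) ⟩
  ∑ S (λ (i , j) → coverage F i j)
    ≡⟨ ∑-swap S (indices F) ⟩
  ∑ (indices F) (λ x → ∑ S λ e → weight F x ℚ.* 𝟙[ inside? x e ])
    ≡⟨ ∑-cong (indices F) (λ x → ∑-*ˡ S (weight F x)) ⟩
  ∑ (indices F) (λ x → weight F x ℚ.* ∑ S λ e → 𝟙[ inside? x e ])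
    ≤⟨ ∑-mono (indices F) (λ x → ℚ.*-monoˡ-≤-nonNeg (weight F x) {{ℚ.nonNegative (weight≥0 F x)}}
         (∑-𝟙≤1 S (inside? x) uniq (atMostOne x))) ⟩
  ∑ (indices F) (λ x → weight F x ℚ.* 1ℚ)
    ≡⟨ ∑-cong (indices F) (λ x → ℚ.*-identityʳ (weight F x)) ⟩
  total F
    ∎
  where
  open ℚ.≤-Reasoning
  inside? : Index F → Fin _ × Fin _ → Bool
  inside? x (i , j) = rows F x i ∧ cols F x j
  atMostOne : ∀ x {e f} → e ∈ˡ S → f ∈ˡ S → inside? x e ≡ true → inside? x f ≡ true → ¬ e ≢ f
  atMostOne x {i , j} {i′ , j′} e∈ f∈ e⊂ f⊂ e≢f = isolated e∈ f∈ e≢f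
    ( Vec.tabulate (rows F x) , Vec.tabulate (cols F x)
    , (λ a b a∈ b∈ → allOnes F x a b (∈-tabulate⁻ (rows F x) a∈) (∈-tabulate⁻ (cols F x) b∈))
    , ( ∈-tabulate⁺ (rows F x) i (proj₁ (∧-true⁻ e⊂))
      , ∈-tabulate⁺ (cols F x) j (proj₂ (∧-true⁻ {rows F x i} e⊂)))
    , ( ∈-tabulate⁺ (rows F x) i′ (proj₁ (∧-true⁻ f⊂))
      , ∈-tabulate⁺ (cols F x) j′ (proj₂ (∧-true⁻ {rows F x i′} f⊂))))

-- Completing an approximate partition to an exact one

module _ {I J : Set} {A : I → J → Bool} (F G : Family A) where

  union : Family A
  union = record
    { indices  = List.map inj₁ (indices F) List.++ List.map inj₂ (indices G)
    ; weight   = Sum.[ weight F , weight G ]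
    ; rows     = Sum.[ rows F , rows G ]
    ; cols     = Sum.[ cols F , cols G ]
    ; weight≥0 = Sum.[ weight≥0 F , weight≥0 G ]
    ; allOnes  = Sum.[ allOnes F , allOnes G ]
    }

  private
    ∑-union : ∀ f → ∑ (indices union) f ≡ ∑ (indices F) (f ∘ inj₁) ℚ.+ ∑ (indices G) (f ∘ inj₂)
    ∑-union f = trans (∑-++ (List.map inj₁ (indices F)) (List.map inj₂ (indices G)))
      (cong₂ ℚ._+_ (∑-map inj₁ (indices F)) (∑-map inj₂ (indices G)))

  total-union : total union ≡ total F ℚ.+ total G
  total-union = ∑-union (weight union)

  coverage-union : ∀ i j → coverage union i j ≡ coverage F i j ℚ.+ coverage G i j
  coverage-union i j = ∑-union (λ x → weight union x ℚ.* 𝟙[ rows union x i ∧ cols union x j ])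

module _ {n m} (A : BinMatrix n m) (w : Fin n → Fin m → ℚ) (w≥0 : ∀ a b → 0ℚ ℚ.≤ w a b) where

  singletons : Family A
  singletons = record
    { indices  = cartesianProduct (allFin n) (allFin m)
    ; weight   = λ (a , b) → w a b
    -- The factor `A a b` empties the rectangle at a zero of `A`, so that all positions can serve as
    -- indices.
    ; rows     = λ (a , b) i → does (i Fin.≟ a) ∧ A a b
    ; cols     = λ (a , b) j → does (j Fin.≟ b)
    ; weight≥0 = λ (a , b) → w≥0 a b
    ; allOnes  = λ (a , b) i j r c →
        trans (cong₂ A (does⁻ (i Fin.≟ a) (proj₁ (∧-true⁻ r))) (does⁻ (j Fin.≟ b) c))
              (proj₂ (∧-true⁻ {does (i Fin.≟ a)} r))
    }

  total-singletons : ∀ {γ} → (∀ a b → w a b ℚ.≤ γ) → total singletons ℚ.≤ ι n ℚ.* (ι m ℚ.* γ)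
  total-singletons {γ} w≤γ = begin
    total singletons
      ≡⟨ ∑-cartesianProduct (allFin n) (allFin m) ⟩
    ∑ (allFin n) (λ a → ∑ (allFin m) (w a))
      ≤⟨ ∑-mono (allFin n) (λ a → ∑-mono (allFin m) (w≤γ a)) ⟩
    ∑ (allFin n) (λ _ → ∑ (allFin m) λ _ → γ)
      ≡⟨ trans (∑-allFin-const n (∑ (allFin m) λ _ → γ)) (cong (ι n ℚ.*_) (∑-allFin-const m γ)) ⟩
    ι n ℚ.* (ι m ℚ.* γ)
      ∎
    where open ℚ.≤-Reasoning

  coverage-singletons : ∀ i j → A i j ≡ true → coverage singletons i j ≡ w i j
  coverage-singletons i j Aij = begin
    coverage singletons i j
      ≡⟨ ∑-cartesianProduct (allFin n) (allFin m) ⟩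
    ∑ (allFin n) (λ a → ∑ (allFin m) λ b → w a b ℚ.* 𝟙[ (does (i Fin.≟ a) ∧ A a b) ∧ does (j Fin.≟ b) ])
      ≡⟨ ∑-cong (allFin n) (λ a → trans
           (∑-cong (allFin m) λ b → factor (w a b) (does (i Fin.≟ a)) (A a b) (does (j Fin.≟ b)))
           (∑-δ (λ b → w a b ℚ.* 𝟙[ A a b ] ℚ.* 𝟙[ does (i Fin.≟ a) ]) j)) ⟩
    ∑ (allFin n) (λ a → w a j ℚ.* 𝟙[ A a j ] ℚ.* 𝟙[ does (i Fin.≟ a) ])
      ≡⟨ ∑-δ (λ a → w a j ℚ.* 𝟙[ A a j ]) i ⟩
    w i j ℚ.* 𝟙[ A i j ]
      ≡⟨ trans (cong (λ b → w i j ℚ.* 𝟙[ b ]) Aij) (ℚ.*-identityʳ (w i j)) ⟩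
    w i j
      ∎
    where
    open ≡-Reasoning
    factor : ∀ w p q r → w ℚ.* 𝟙[ (p ∧ q) ∧ r ] ≡ w ℚ.* 𝟙[ q ] ℚ.* 𝟙[ p ] ℚ.* 𝟙[ r ]
    factor w p q r = trans
      (cong (w ℚ.*_) (trans (𝟙-∧ (p ∧ q) r) (cong (ℚ._* 𝟙[ r ]) (𝟙-∧ p q))))
      (solve 4 (λ w p q r → w :* ((p :* q) :* r) := w :* q :* p :* r) refl w 𝟙[ p ] 𝟙[ q ] 𝟙[ r ])
      where open ℚSolver.+-*-Solver

module _ {n m} (A : BinMatrix n m) (F : Family A) {t γ : ℚ} (t≥1 : 1ℚ ℚ.≤ t) (γ≥0 : 0ℚ ℚ.≤ γ)
         (cov≤t : ∀ i j → A i j ≡ true → coverage F i j ℚ.≤ t)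
         (t≤cov : ∀ i j → A i j ≡ true → t ℚ.≤ coverage F i j ℚ.+ γ) where

  private
    gate : Bool → ℚ → ℚ
    gate b p = if b then p else 0ℚ

    -- At a zero of `A` nothing is covered and the difference would be all of `t`, which `γ` need
    -- not bound; `gate` replaces it by zero.
    deficit : Fin n → Fin m → ℚ
    deficit a b = gate (A a b) (t ℚ.- coverage F a b)

    open ℚSolver.+-*-Solver

    diff≥0 : ∀ {c} → c ℚ.≤ t → 0ℚ ℚ.≤ t ℚ.- c
    diff≥0 {c} c≤t = subst (ℚ._≤ t ℚ.- c) (ℚ.+-inverseʳ c) (ℚ.+-monoˡ-≤ (ℚ.- c) c≤t)

    diff≤γ : ∀ {c} → t ℚ.≤ c ℚ.+ γ → t ℚ.- c ℚ.≤ γ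
    diff≤γ {c} t≤ = subst (t ℚ.- c ℚ.≤_) (cancel c γ) (ℚ.+-monoˡ-≤ (ℚ.- c) t≤)
      where
      cancel : ∀ c g → c ℚ.+ g ℚ.- c ≡ g
      cancel = solve 2 (λ c g → c :+ g :- c := g) refl

    deficit≥0 : ∀ a b → 0ℚ ℚ.≤ deficit a b
    deficit≥0 a b = cases (A a b) (λ Aab → diff≥0 (cov≤t a b Aab))
      where
      cases : ∀ c {p} → (c ≡ true → 0ℚ ℚ.≤ p) → 0ℚ ℚ.≤ gate c p
      cases true  p≥0 = p≥0 refl
      cases false _   = ℚ.≤-refl

    deficit≤γ : ∀ a b → deficit a b ℚ.≤ γ
    deficit≤γ a b = cases (A a b) (λ Aab → diff≤γ (t≤cov a b Aab))
      where
      cases : ∀ c {p} → (c ≡ true → p ℚ.≤ γ) → gate c p ℚ.≤ γ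
      cases true  p≤γ = p≤γ refl
      cases false _   = γ≥0

    S = singletons A deficit deficit≥0
    G = union F S

    coverage-G : ∀ i j → A i j ≡ true → coverage G i j ≡ t
    coverage-G i j Aij = trans (coverage-union F S i j)
      (trans (cong (coverage F i j ℚ.+_) (trans (coverage-singletons A deficit deficit≥0 i j Aij)
               (cong (λ b → gate b (t ℚ.- coverage F i j)) Aij)))
             (restore (coverage F i j) t))
      where
      restore : ∀ c t → c ℚ.+ (t ℚ.- c) ≡ t
      restore = solve 2 (λ c t → c :+ (t :- c) := t) refl

  -- Singletons fill the coverage up to the constant t ≥ 1, by which everything is then divided.
  completed-partition : ∃ λ T → PartitionOf A T × T ℚ.≤ total F ℚ.+ ι n ℚ.* (ι m ℚ.* γ)
  completed-partition = from (inverse (ℚ.<-≤-trans (ℚ.positive⁻¹ 1ℚ) t≥1))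
    where
    Goal = ∃ λ T → PartitionOf A T × T ℚ.≤ total F ℚ.+ ι n ℚ.* (ι m ℚ.* γ)
    from : (∃ λ r → 0ℚ ℚ.< r × t ℚ.* r ≡ 1ℚ) → Goal
    from (r , r>0 , tr≡1) = r ℚ.* total G
      , ( scale r r≥0 G
        , (λ i j Aij → trans (coverage-scale r r≥0 G i j) (trans (cong (r ℚ.*_) (coverage-G i j Aij))
             (trans (ℚ.*-comm r t) tr≡1)))
        , total-scale r r≥0 G)
      , (begin
          r ℚ.* total G                             ≤⟨ ℚ.*-monoʳ-≤-nonNeg (total G)
                                                         {{ℚ.nonNegative (total≥0 G)}} r≤1 ⟩
          1ℚ ℚ.* total G                            ≡⟨ ℚ.*-identityˡ (total G) ⟩
          total G                                   ≡⟨ total-union F S ⟩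
          total F ℚ.+ total S
                                                    ≤⟨ ℚ.+-monoʳ-≤ (total F)
                                                         (total-singletons A deficit deficit≥0 deficit≤γ) ⟩
          total F ℚ.+ ι n ℚ.* (ι m ℚ.* γ)           ∎)
      where
      open ℚ.≤-Reasoning
      r≥0 = ℚ.<⇒≤ r>0
      r≤1 : r ℚ.≤ 1ℚ
      r≤1 = subst₂ ℚ._≤_ (ℚ.*-identityˡ r) tr≡1 (ℚ.*-monoʳ-≤-nonNeg r {{ℚ.nonNegative r≥0}} t≥1)

module _ {n m} (A : BinMatrix n m) where

  private N = #bicliques A

  -- `PartitionOf` lives in `Set₁`, whereas `Eventually` takes predicates in `Set`; the exact
  -- rational partition near `x` is therefore passed to a continuation with values in `X`.
  approximate-partition : ∀ x → Partition A x → NonNegative A x → ∀ {ε} → 0ℚ ℚ.< ε →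
    ∀ {X : ℕ → Set} → (∀ k T → PartitionOf A T → T ℚ.≤ seq (sum x) k ℚ.+ ε → X k) → Eventually X
  approximate-partition x partition x≥0 {ε} ε>0 {X} use =
    -- The total grows by `δ` through the shift and by at most `3 δ` for each of the `n m`
    -- singletons.
    choose-δ (split-evenly (1 ℕ.+ n ℕ.* (m ℕ.* 3)) ε>0)
    where
    open ℚSolver.+-*-Solver
    module _ (δ : ℚ) (δ>0 : 0ℚ ℚ.< δ) (δ≤ : ι (1 ℕ.+ n ℕ.* (m ℕ.* 3)) ℚ.* δ ℚ.≤ ε)
             (η : ℚ) (η>0 : 0ℚ ℚ.< η) (Nη≤δ : ι N ℚ.* η ℚ.≤ δ) where
      t γ : ℚ
      -- Late terms of `Mx` lie between `1 - δ` and `1 + δ` on the one-entries, and the shift adds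
      -- at most `δ`. So the coverage lies between `t - 3 δ` and `t`.
      t = 1ℚ ℚ.+ δ ℚ.+ δ
      γ = ι 3 ℚ.* δ
      δ≥0 = ℚ.<⇒≤ δ>0
      t≥1 : 1ℚ ℚ.≤ t
      t≥1 = ℚ.≤-trans (p≤p+ε 1ℚ δ≥0) (p≤p+ε (1ℚ ℚ.+ δ) δ≥0)
      γ≥0 = *-nonNeg (ι≥0 3) δ≥0
      1+3nm : ∀ s → s ℚ.+ δ ℚ.+ ι n ℚ.* (ι m ℚ.* γ) ≡ s ℚ.+ ι (1 ℕ.+ n ℕ.* (m ℕ.* 3)) ℚ.* δ
      1+3nm s = trans (distribute s δ (ι n) (ι m) (ι 3) 1ℚ (ℚ.*-identityˡ δ)) (cong (λ e → s ℚ.+ e ℚ.* δ) (sym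
        (trans (ι-+ 1 (n ℕ.* (m ℕ.* 3))) (cong (1ℚ ℚ.+_)
        (trans (ι-* n (m ℕ.* 3)) (cong (ι n ℚ.*_) (ι-* m 3)))))))
        where
        distribute : ∀ s d a b c u → u ℚ.* d ≡ d →
          s ℚ.+ d ℚ.+ a ℚ.* (b ℚ.* (c ℚ.* d)) ≡ s ℚ.+ (u ℚ.+ a ℚ.* (b ℚ.* c)) ℚ.* d
        distribute s d a b c u ud≡d = trans (cong (λ e → s ℚ.+ e ℚ.+ a ℚ.* (b ℚ.* (c ℚ.* d))) (sym ud≡d))
          (solve 6 (λ s d a b c u → s :+ u :* d :+ a :* (b :* (c :* d)) := s :+ (u :+ a :* (b :* c)) :* d)
            refl s d a b c u)
      t≤ : ∀ c → 1ℚ ℚ.≤ c ℚ.+ δ → t ℚ.≤ c ℚ.+ γ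
      t≤ c le = ℚ.≤-trans (ℚ.+-monoˡ-≤ δ (ℚ.+-monoˡ-≤ δ le)) (ℚ.≤-reflexive
        (trans (solve 2 (λ c d → c :+ d :+ d :+ d := c :+ (d :+ d :+ d)) refl c δ)
               (cong (c ℚ.+_) triple)))
        where
        triple : δ ℚ.+ δ ℚ.+ δ ≡ γ
        triple = trans (cong₂ ℚ._+_ (cong₂ ℚ._+_ δ≡1δ δ≡1δ) δ≡1δ)
          (trans (cong (ℚ._+ 1ℚ ℚ.* δ) (sym (ℚ.*-distribʳ-+ δ 1ℚ 1ℚ)))
                 (sym (ℚ.*-distribʳ-+ δ (1ℚ ℚ.+ 1ℚ) 1ℚ)))
          where δ≡1δ = sym (ℚ.*-identityˡ δ)
      step : ∀ k → (∀ b → 0ℚ ℚ.≤ seq (x b) k ℚ.+ η) →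
             (∀ i j → A i j ≡ true → seq ((M·_ A x) i j) k ℚ.≤ 1ℚ ℚ.+ δ
                                   × 1ℚ ℚ.≤ seq ((M·_ A x) i j) k ℚ.+ δ) →
             X k
      step k shift≥0 near = finish (completed-partition A F t≥1 γ≥0
        (λ i j Aij → ℚ.≤-trans (coverage-shifted-≤ A x η>0 Nη≤δ k shift≥0 i j)
                               (ℚ.+-monoˡ-≤ δ (proj₁ (near i j Aij))))
        (λ i j Aij → t≤ (coverage F i j) (ℚ.≤-trans (proj₂ (near i j Aij))
                       (ℚ.+-monoˡ-≤ δ (coverage-shifted-≥ A x η>0 Nη≤δ k shift≥0 i j)))))
        where
        F = shifted A x η>0 Nη≤δ k shift≥0
        finish : (∃ λ T → PartitionOf A T × T ℚ.≤ total F ℚ.+ ι n ℚ.* (ι m ℚ.* γ)) → X k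
        finish (T , P , T≤) = use k T P (ℚ.≤-trans T≤ (ℚ.≤-trans
          (ℚ.+-monoˡ-≤ (ι n ℚ.* (ι m ℚ.* γ)) (total-shifted A x η>0 Nη≤δ k shift≥0))
          (ℚ.≤-trans (ℚ.≤-reflexive (1+3nm (seq (sum x) k))) (ℚ.+-monoʳ-≤ (seq (sum x) k) δ≤))))
      conclude : Eventually X
      conclude = eventually-map (λ k (shift≥0 , near) → step k shift≥0 near)
        (eventually-× (eventually-shift≥0 A x η>0 Nη≤δ x≥0)
          (eventually-∀ λ i → eventually-∀ λ j → eventually-→ λ Aij →
            eventually-× (proj₁ (partition i j Aij) δ δ>0) (proj₂ (partition i j Aij) δ δ>0)))
    choose-η : ∀ δ → 0ℚ ℚ.< δ → ι (1 ℕ.+ n ℕ.* (m ℕ.* 3)) ℚ.* δ ℚ.≤ ε →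
               (∃ λ η → 0ℚ ℚ.< η × ι N ℚ.* η ℚ.≤ δ) → Eventually X
    choose-η δ δ>0 δ≤ (η , η>0 , Nη≤δ) = conclude δ δ>0 δ≤ η η>0 Nη≤δ
    choose-δ : (∃ λ δ → 0ℚ ℚ.< δ × ι (1 ℕ.+ n ℕ.* (m ℕ.* 3)) ℚ.* δ ℚ.≤ ε) → Eventually X
    choose-δ (δ , δ>0 , δ≤) = choose-η δ δ>0 δ≤ (split-evenly N δ>0)

-- Bounds on the asymptotic fractional binary rank

module _ {n m} (A : BinMatrix n m) (L : ℝ) (isL : Is-bpf∞ A L) where

  bpf∞-lower : ∀ {q} → 0ℚ ℚ.≤ q → LowerBound A q → fromℚ q ≤ L
  bpf∞-lower {q} q≥0 lb = limit-≥ (proj₁ isL) L (fromℚ q) (proj₂ (proj₂ isL)) λ k →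
    at k (proj₁ (proj₂ isL) k)
    where
    at : ∀ k .{{_ : ℕ.NonZero k}} {r} → (∃ λ v → Is-bpf (A ^⊗ k) v × IsRoot k v r) → fromℚ q ≤ r
    at k {r} (v , ((x , (partition , x≥0) , sum≃v) , _) , root) = root-≥ {k} {v} {r} root q≥0
      (≤-trans (fromℚ (q ^ℚ k)) (sum x) v
        (lowerBound≤sum (A ^⊗ k) x (^-nonNeg k q≥0) (power-lowerBound q≥0 lb k)
          (λ i j Aij → proj₂ (partition i j Aij)) x≥0)
        (proj₁ sum≃v))

  bpf∞-upper : ∀ q p .{{_ : ℕ.NonZero p}} → 0ℚ ℚ.≤ q →
    (∀ j → ∃ λ t → PartitionOf (A ^⊗ (ℕ.suc j ℕ.* p)) t × t ℚ.≤ q ^ℚ (ℕ.suc j ℕ.* p)) → L ≤ fromℚ q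
  bpf∞-upper q p q≥0 bound = limit-≤ (proj₁ isL) L (fromℚ q) p (proj₂ (proj₂ isL)) λ j →
    at (ℕ.suc j ℕ.* p) {{ℕ.m*n≢0 (ℕ.suc j) p}}
       (proj₁ (proj₂ isL) (ℕ.suc j ℕ.* p) {{ℕ.m*n≢0 (ℕ.suc j) p}}) (bound j)
    where
    at : ∀ k .{{_ : ℕ.NonZero k}} {r} → (∃ λ v → Is-bpf (A ^⊗ k) v × IsRoot k v r) →
         (∃ λ t → PartitionOf (A ^⊗ k) t × t ℚ.≤ q ^ℚ k) → r ≤ fromℚ q
    at k {r} (v , isbpf , root) (t , P , t≤) = root-≤ {k} {v} {r} root q≥0
      (≤-trans v (fromℚ t) (fromℚ (q ^ℚ k)) (bpf≤total (A ^⊗ k) v t isbpf P)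
        (pointwise-≤ (fromℚ t) (fromℚ (q ^ℚ k)) λ _ → t≤))

  bpf∞≤partition : ∀ T → PartitionOf A T → L ≤ fromℚ T
  bpf∞≤partition T P@(F , _ , tF) = bpf∞-upper T 1 (subst (0ℚ ℚ.≤_) tF (total≥0 F)) λ j →
    T ^ℚ (ℕ.suc j ℕ.* 1) , power-partition P (ℕ.suc j ℕ.* 1) , ℚ.≤-refl

  -- The minimiser is real, while powers are formed of rational families; exact rational partitions
  -- with total at most `ε` above a late term of its total bridge the gap.
  bpf∞≤bpf : ∀ v → Is-bpf A v → L ≤ v
  bpf∞≤bpf v ((x , (partition , x≥0) , sum≃v) , _) = ≤-trans L (sum x) v
    (≤-fromAbove L (sum x) λ ε ε>0 → approximate-partition A x partition x≥0 ε>0 λ k T P T≤ →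
      ≤-trans L (fromℚ T) (fromℚ (seq (sum x) k ℚ.+ ε)) (bpf∞≤partition T P)
        (pointwise-≤ (fromℚ T) (fromℚ (seq (sum x) k ℚ.+ ε)) λ _ → T≤))
    (proj₁ sum≃v)

  bcf≤bpf∞ : ∀ c → Is-bcf A c → c ≤ L
  bcf≤bpf∞ c isbcf@((x , (cover , x≥0) , sum≃c) , _) = ≤-fromBelow c L
    -- Zero is a lower bound for every family, which yields the `0 ≤ c` that `≤-fromBelow` asks for.
    (≤-trans 0ℝ (sum x) c
      (lowerBound≤sum A x ℚ.≤-refl
        (λ F t _ _ → subst (ℚ._≤ total F) (sym (ℚ.*-zeroʳ t)) (total≥0 F)) cover x≥0)
      (proj₁ sum≃c))
    λ q q≥0 q≤c → bpf∞-lower q≥0 (bcf-lowerBound A c q isbcf q≤c)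

i≤bcf : ∀ {n m} (A : BinMatrix n m) i c → Is-i A i → Is-bcf A c → fromℕ i ≤ c
i≤bcf A _ c ((S , isolation , refl) , _) ((x , (cover , x≥0) , sum≃c) , _) =
  ≤-trans (fromℕ (length S)) (sum x) c
    (lowerBound≤sum A x (ι≥0 (length S)) (isolation-lowerBound isolation) cover x≥0)
    (proj₁ sum≃c)

bpf≤bp : ∀ {n m} (A : BinMatrix n m) v w → Is-bpf A v → Is-bp A w → v ≤ w
bpf≤bp A v w (_ , minimal) ((x , (partition , zeroOne) , sum≃w) , _) =
  ≤-trans v (sum x) w (minimal x (partition , λ b → nonNegative b (zeroOne b))) (proj₁ sum≃w)
  where
  nonNegative : ∀ b → x b ≃ 0ℝ ⊎ x b ≃ 1ℝ → 0ℝ ≤ x b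
  nonNegative b (inj₁ x≃0) = proj₂ x≃0
  nonNegative b (inj₂ x≃1) = ≤-trans 0ℝ 1ℝ (x b) (pointwise-≤ 0ℝ 1ℝ λ _ → 0≤1) (proj₂ x≃1)

-- An all-ones submatrix through both opposite corners would contain the zero at `0F , 2F`. This
-- pair is the source of the lower bound 2.
domino-isolation : IsIsolationSet domino ((0F , 0F) ∷ (2F , 2F) ∷ [])
domino-isolation =
    ((λ ()) ∷ []) ∷ [] ∷ []
  , (λ { (here refl) → refl ; (there (here refl)) → refl })
  , isolated
  where
  isolated : ∀ {e f} → e ∈ˡ (0F , 0F) ∷ (2F , 2F) ∷ [] → f ∈ˡ (0F , 0F) ∷ (2F , 2F) ∷ [] →
             e ≢ f → ¬ InCommonAllOnes domino e f
  isolated (here refl)         (here refl)         e≢f _ = e≢f refl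
  isolated (there (here refl)) (there (here refl)) e≢f _ = e≢f refl
  isolated (here refl)         (there (here refl)) _ (U , V , ones , (0∈U , 0∈V) , (2∈U , 2∈V))
    with () ← ones 0F 2F 0∈U 2∈V
  isolated (there (here refl)) (here refl)         _ (U , V , ones , (2∈U , 2∈V) , (0∈U , 0∈V))
    with () ← ones 0F 2F 0∈U 2∈V

-- Only exponents divisible by five are examined: the `suc j`-th power of the certificate partitions
-- `domino ^⊗ (suc j * 5)`.
domino-upper : ∀ L → Is-bpf∞ domino L → L ≤ fromℚ (+ 2372713 / 1000000)
domino-upper L isL = from domino-partition
  where
  c = + 2372713 / 1000000
  c≥0 : 0ℚ ℚ.≤ c
  c≥0 = ℚ.nonNegative⁻¹ c {{ℚ.normalize-nonNeg 2372713 1000000}}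
  from : (∃ λ t → PartitionOf (onWords {k = 5} domino) t × t ℚ.≤ c ^ℚ 5) → L ≤ fromℚ c
  from (t , P@(F , _ , tF) , t≤) = bpf∞-upper domino L isL c 5 c≥0 λ j →
      t ^ℚ ℕ.suc j
    , wordPower-partition P (ℕ.suc j)
    , subst (t ^ℚ ℕ.suc j ℚ.≤_)
        (trans (Exp.^-assocʳ c 5 (ℕ.suc j)) (cong (c ^ℚ_) (ℕ.*-comm 5 (ℕ.suc j))))
        (^-mono-≤ (ℕ.suc j) (subst (0ℚ ℚ.≤_) tF (total≥0 F)) t≤)

theorem2 : (∀ (L : ℝ) → Is-bpf∞ domino L →
    fromℕ 2 ≤ L × L ≤ fromℚ (+ 2372713 / 1000000))
    × (∀ {n m : ℕ} (A : BinMatrix n m) (i : ℕ) (bcf bpf∞ bpf bp : ℝ) →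
    Is-i A i → Is-bcf A bcf → Is-bpf∞ A bpf∞ → Is-bpf A bpf → Is-bp A bp →
    fromℕ i ≤ bcf × bcf ≤ bpf∞ × bpf∞ ≤ bpf × bpf ≤ bp)
theorem2 =
    (λ L isL → bpf∞-lower domino L isL {ι 2} (ι≥0 2) (isolation-lowerBound domino-isolation) ,
              domino-upper L isL)
  , (λ A i bcf bpf∞ bpf bp isi isbcf isbpf∞ isbpf isbp →
       i≤bcf A i bcf isi isbcf , bcf≤bpf∞ A bpf∞ isbpf∞ bcf isbcf ,
       bpf∞≤bpf A bpf∞ isbpf∞ bpf isbpf , bpf≤bp A bpf bp isbpf isbp)
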